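{- Let $H$ be a finite graph without multiple edges, possibly with loops, with no isolated vertices, and with maximum degree $\Delta$ (loops counting once toward the degree). Suppose that \[ \hom(K_2,H) = \sum_{v \in V(H)} d(v) < \Delta^2 . \] Then there exists a constant $c_H$, depending only on $H$, such that for every integer $\delta\ge 1$, all $n \geq (c_H)^\delta$ and all $G \in \mathcal{G}(n,\delta)$, \[ \hom(G,H) \leq \hom(K_{\delta,n-\delta},H), \] with equality only for $G=K_{\delta,n-\delta}$. If $H$ also has the property that all vertices of degree $\Delta$ share the same $\Delta$ neighbors, then there is a constant $c_H$, depending only on $H$, such that the same result holds for every $\delta \ge 1$ and all $n \geq c_H \delta^2$.
   Context: For a finite simple (loopless) graph $G$ and a finite graph $H$ (no multiple edges, loops allowed), $\hom(G,H)$ is the number of maps $f:V(G)\to V(H)$ such that $v\sim_G w$ implies $f(v)\sim_H f(w)$. For $v\in V(H)$, $d(v)$ is the degree of $v$, where a loop counts once (so a looped vertex is a neighbor of itself); $\Delta=\max_{v\in V(H)} d(v)$. A vertex of $H$ is isolated if it is incident to no edge and no loop. $\mathcal{G}(n,\delta)$ is the set of all $n$-vertex finite simple graphs with minimum degree (exactly) $\delta$. $K_{a,b}$ is the complete bipartite graph with parts of sizes $a$ and $b$. Graph equality is up to isomorphism. -}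

module Defs where

open import Level using (0ℓ)
open import Data.Bool.Base using (true; false)
open import Data.Empty using (⊥)
open import Data.Fin.Base using (Fin; zero; suc; splitAt)
open import Data.Fin.Properties using (_≟_; all?)
open import Data.List.Base
  using (List; []; _∷_; _++_; [_]; map; length; filter; allFin; cartesianProductWith)
open import Data.List.Extrema.Nat using (max)
open import Data.List.Properties
  using (filter-++; length-++; filter-≐; map-cong)
open import Data.Nat.Base using (ℕ; zero; suc; _+_; _∸_; _≤_)
open import Data.Nat.ListAction using (sum)
open import Data.Product.Base using (Σ-syntax; ∃-syntax; _×_; _,_)
open import Data.Sum.Base using (_⊎_; inj₁; inj₂)
open import Data.Unit.Base using (⊤)
open import Data.Vec.Base using (Vec; []; _∷_; lookup)
open import Function.Bundles using (_↔_; _⇔_; Inverse)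
open import Relation.Binary.Core using (Rel)
open import Relation.Binary.Definitions using (Decidable; Symmetric; Irreflexive)
open import Relation.Binary.PropositionalEquality
  using (_≡_; _≢_; refl; sym; trans; cong; cong₂; ≢-sym)
open import Relation.Nullary.Decidable using (does; yes; no; ¬?; _→-dec_)
open import Relation.Unary using (Pred) renaming (Decidable to Decidable₁)

-- Loops are allowed; there are no multiple edges since adjacency is a relation.
record Graph (n : ℕ) : Set₁ where
  infix 4 _~_ _~?_
  field
    _~_   : Rel (Fin n) 0ℓ
    ~-sym : Symmetric _~_
    _~?_  : Decidable _~_

record SimpleGraph (n : ℕ) : Set₁ where
  field
    graph    : Graph n
  open Graph graph public
  field
    loopless : Irreflexive _≡_ _~_

open SimpleGraph using (graph)

-- The number of neighbours, so a loop contributes exactly 1.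
degree : ∀ {n} → Graph n → Fin n → ℕ
degree {n} G v = length (filter (v ~?_) (allFin n))
  where open Graph G

degreeSum : ∀ {n} → Graph n → ℕ
degreeSum {n} G = sum (map (degree G) (allFin n))

maxDegree : ∀ {n} → Graph n → ℕ
maxDegree {n} G = max 0 (map (degree G) (allFin n))

-- The minimum degree is exactly δ, i.e. δ is a lower bound that is attained.
HasMinDegree : ∀ {n} → Graph n → ℕ → Set
HasMinDegree {n} G δ = (∀ v → δ ≤ degree G v) × (∃[ v ] degree G v ≡ δ)

-- The witness w may be v itself: a looped vertex is not isolated.
NoIsolated : ∀ {n} → Graph n → Set
NoIsolated G = ∀ v → ∃[ w ] v ~ w
  where open Graph G

MaxDegreeVerticesShareNeighbours : ∀ {n} → Graph n → Set
MaxDegreeVerticesShareNeighbours H =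
  ∀ u v → degree H u ≡ maxDegree H → degree H v ≡ maxDegree H →
  ∀ w → (u ~ w) ⇔ (v ~ w)
  where open Graph H

infix 4 _≅_

_≅_ : ∀ {m n} → Graph m → Graph n → Set
_≅_ {m} {n} G H = Σ[ φ ∈ Fin m ↔ Fin n ]
  (∀ u v → (u G.~ v) ⇔ (Inverse.to φ u H.~ Inverse.to φ v))
  where
    module G = Graph G
    module H = Graph H

complete : ∀ n → SimpleGraph n
complete n = record
  { graph = record
    { _~_   = _≢_
    ; ~-sym = ≢-sym
    ; _~?_  = λ u v → ¬? (u ≟ v)
    }
  ; loopless = λ u≡v u≢v → u≢v u≡v
  }

K₂ : SimpleGraph 2
K₂ = complete 2

OppositeSides : ∀ {a b} → Rel (Fin a ⊎ Fin b) 0ℓ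
OppositeSides (inj₁ _) (inj₁ _) = ⊥
OppositeSides (inj₁ _) (inj₂ _) = ⊤
OppositeSides (inj₂ _) (inj₁ _) = ⊤
OppositeSides (inj₂ _) (inj₂ _) = ⊥

oppositeSides-sym : ∀ {a b} → Symmetric (OppositeSides {a} {b})
oppositeSides-sym {_} {_} {inj₁ _} {inj₂ _} p = p
oppositeSides-sym {_} {_} {inj₂ _} {inj₁ _} p = p

oppositeSides? : ∀ {a b} → Decidable (OppositeSides {a} {b})
oppositeSides? (inj₁ _) (inj₁ _) = no λ ()
oppositeSides? (inj₁ _) (inj₂ _) = yes _
oppositeSides? (inj₂ _) (inj₁ _) = yes _
oppositeSides? (inj₂ _) (inj₂ _) = no λ ()

oppositeSides-irrefl : ∀ {a b} → Irreflexive _≡_ (OppositeSides {a} {b})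
oppositeSides-irrefl {_} {_} {inj₁ _} refl ()
oppositeSides-irrefl {_} {_} {inj₂ _} refl ()

-- The parts are the first a and the last b vertices.
completeBipartite : ∀ a b → SimpleGraph (a + b)
completeBipartite a b = record
  { graph = record
    { _~_   = λ u v → OppositeSides (splitAt a u) (splitAt a v)
    ; ~-sym = λ {u} {v} → oppositeSides-sym {x = splitAt a u} {y = splitAt a v}
    ; _~?_  = λ u v → oppositeSides? (splitAt a u) (splitAt a v)
    }
  ; loopless = λ u≡v → oppositeSides-irrefl (cong (splitAt a) u≡v)
  }

-- All maps Fin n → Fin m, each listed once as its vector of values.
allMaps : ∀ n m → List (Vec (Fin m) n)
allMaps zero    m = [ [] ]
allMaps (suc n) m = cartesianProductWith _∷_ (allFin m) (allMaps n m)

IsHom : ∀ {n m} → SimpleGraph n → Graph m → Vec (Fin m) n → Set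
IsHom G H f = ∀ u v → u G.~ v → lookup f u H.~ lookup f v
  where
    module G = SimpleGraph G
    module H = Graph H

isHom? : ∀ {n m} (G : SimpleGraph n) (H : Graph m) → Decidable₁ (IsHom G H)
isHom? G H f = all? λ u → all? λ v → (u G.~? v) →-dec (lookup f u H.~? lookup f v)
  where
    module G = SimpleGraph G
    module H = Graph H

hom : ∀ {n m} → SimpleGraph n → Graph m → ℕ
hom {n} {m} G H = length (filter (isHom? G H) (allMaps n m))

-- Among n-vertex graphs of minimum degree δ, K_{δ,n-δ} is the unique maximiser of
-- hom(-,H).  The truncation in n ∸ δ is harmless: minimum degree δ forces δ < n.
UniquelyMaximised : ∀ {m} → Graph m → (δ n : ℕ) → Set₁
UniquelyMaximised H δ n =
  (G : SimpleGraph n) → HasMinDegree (graph G) δ →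
    hom G H ≤ hom Kδ H × (hom G H ≡ hom Kδ H → graph G ≅ graph Kδ)
  where Kδ = completeBipartite δ (n ∸ δ)

count : ∀ {A : Set} {P : Pred A 0ℓ} → Decidable₁ P → List A → ℕ
count P? xs = length (filter P? xs)

count-map : ∀ {A B : Set} {P : Pred B 0ℓ} (P? : Decidable₁ P) (f : A → B) xs →
            count P? (map f xs) ≡ count (λ x → P? (f x)) xs
count-map P? f []       = refl
count-map P? f (x ∷ xs) with does (P? (f x))
... | true  = cong suc (count-map P? f xs)
... | false = count-map P? f xs

count-product : ∀ {A B C : Set} {P : Pred C 0ℓ} (P? : Decidable₁ P)
                (f : A → B → C) xs ys →
                count P? (cartesianProductWith f xs ys)
                ≡ sum (map (λ x → count (λ y → P? (f x y)) ys) xs)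
count-product P? f []       ys = refl
count-product P? f (x ∷ xs) ys =
  trans (cong length (filter-++ P? (map (f x) ys) _))
  (trans (length-++ (filter P? (map (f x) ys)))
         (cong₂ _+_ (count-map P? (f x) ys) (count-product P? f xs ys)))

product-[y] : ∀ {A B C : Set} (f : A → B → C) xs y →
              cartesianProductWith f xs [ y ] ≡ map (λ x → f x y) xs
product-[y] f []       y = refl
product-[y] f (x ∷ xs) y = cong (f x y ∷_) (product-[y] f xs y)

hom-K₂ : ∀ {m} (H : Graph m) → hom K₂ H ≡ degreeSum H
hom-K₂ {m} H =
  trans (count-product (isHom? K₂ H) _∷_ (allFin m) (allMaps 1 m))
        (cong sum (map-cong row (allFin m)))
  where
  open Graph H

  to : ∀ {x y} → IsHom K₂ H (x ∷ y ∷ []) → x ~ y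
  to f = f zero (suc zero) λ ()

  from : ∀ {x y} → x ~ y → IsHom K₂ H (x ∷ y ∷ [])
  from e zero       zero       z≢z with () ← z≢z refl
  from e zero       (suc zero) _   = e
  from e (suc zero) zero       _   = ~-sym e
  from e (suc zero) (suc zero) s≢s with () ← s≢s refl

  row : ∀ x → count (λ f → isHom? K₂ H (x ∷ f)) (allMaps 1 m) ≡ degree H x
  row x =
    trans (cong (count (λ f → isHom? K₂ H (x ∷ f))) (product-[y] _∷_ (allFin m) []))
    (trans (count-map (λ f → isHom? K₂ H (x ∷ f)) (λ y → y ∷ []) (allFin m))
           (cong length (filter-≐ (λ y → isHom? K₂ H (x ∷ y ∷ [])) (x ~?_)
                                  (to , from) (allFin m))))

{-# OPTIONS --safe #-}

-- Write h = hom(K₂,H) < Δ².  Colouring vertices one after another shows that a partial colouring of G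
-- extends in at most Δ^r ways when r vertices are left, with Δ² improved to h for each of a family of
-- disjoint edges among these r vertices.  On the other side hom(K_{δ,n-δ},H) ≥ |S| Δ^(n-δ), where S is
-- the nonempty set of δ-tuples of colours with Δ common neighbours.  Hence a matching of size κδ in G,
-- with κ depending on H only, makes hom(G,H) too small.  Otherwise a maximal matching gives a vertex
-- cover C of size at most 2κδ.  For n large C contains a set W of δ vertices such that every colouring
-- of W outside S leaves at most Δ-1 colours to many vertices: either W has many common neighbours
-- (pigeonhole on the neighbourhoods inside C, exponential in δ), or, when the vertices of degree Δ share
-- their neighbours, it is enough that each vertex of W has many neighbours (quadratic in δ).  Colourings
-- of W outside S then hardly count, and an edge of G - W costs a factor h/Δ² on those inside S.  If
-- G - W has no edge, then G is K_{δ,n-δ} plus edges inside W, and such an edge destroys a colouring,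
-- since the neighbours of a vertex of degree Δ cannot form a looped clique.
module Submission where

open import Data.Bool.Base using (true; false; if_then_else_)
open import Data.Empty using (⊥-elim)
open import Data.Fin.Base using (Fin; zero; suc; splitAt; _↑ˡ_)
open import Data.Fin.Properties using (_≟_; all?; any?)
open import Data.List.Base
  using (List; []; _∷_; _++_; [_]; length; filter; concatMap; take; map; allFin; cartesianProduct; cartesianProductWith)
open import Data.List.Extrema.Nat using (xs≤max; argmax-sel)
open import Data.List.Membership.Propositional using (_∈_; _∉_; lose; find)
open import Data.List.Membership.Propositional.Properties
open import Data.List.Properties
  using (length-++; length-map; length-take; length-tabulate; length-filter; filter-accept; filter-reject; length-++-sucʳ)
open import Data.List.Relation.Binary.Permutation.Propositional
  using (_↭_; ↭-refl; ↭-trans; prep; ↭⇒↭ₛ)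
open import Data.List.Relation.Binary.Permutation.Propositional.Properties using (shift; ↭-length; ∈-resp-↭)
import Data.List.Relation.Binary.Permutation.Setoid.Properties as PermSetoid
open import Data.List.Relation.Binary.Subset.Propositional using (_⊆_)
open import Data.List.Relation.Binary.Subset.Propositional.Properties using (filter-⊆)
open import Data.List.Relation.Unary.All as All using (All; []; _∷_)
open import Data.List.Relation.Unary.All.Properties using (++⁻ˡ)
import Data.List.Relation.Unary.AllPairs as AllPairs
open AllPairs using ([]; _∷_)
open import Data.List.Relation.Unary.Any as Any using (Any; here; there)
open import Data.List.Relation.Unary.Unique.Propositional using (Unique)
import Data.List.Relation.Unary.Unique.Propositional.Properties as Unique
open import Data.Nat.Base
open import Data.Nat.Properties hiding (_≟_)
open import Data.Nat.Solver using (module +-*-Solver)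
open import Data.Product.Base using (_×_; _,_; ∃-syntax; proj₁; proj₂)
open import Data.Product.Properties using (≡-dec)
open import Data.Sum.Base using (_⊎_; inj₁; inj₂; fromInj₁; fromInj₂; [_,_]′)
  renaming (map₁ to ⊎-map₁; map to ⊎-map)
open import Data.Vec.Base as Vec using (Vec; []; _∷_; lookup; toList; fromList)
open import Data.Vec.Membership.Propositional using () renaming (_∈_ to _∈ᵥ_)
open import Data.Vec.Membership.Propositional.Properties
  using (∈-toList⁺; ∈-toList⁻; ∈-fromList⁺)
  renaming (∈-lookup to ∈ᵥ-lookup; ∈-++⁺ˡ to ∈ᵥ-++⁺ˡ; ∈-++⁺ʳ to ∈ᵥ-++⁺ʳ)
open import Data.Vec.Properties
  using (∷-injective; tabulate-cong; tabulate∘lookup; lookup∘tabulate; lookup-map; lookup-splitAt; lookup-++ˡ;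
         lookup-replicate; ++-injectiveˡ; ++-injectiveʳ; take++drop≡id; toList-++; length-toList; toList∘fromList)
  renaming (≡-dec to Vec≡-dec)
import Data.Vec.Relation.Unary.Any as AnyV
open import Data.Vec.Relation.Unary.Any.Properties using (lookup-index)
open import Function.Base using (_∘_)
open import Function.Bundles using (mk⇔; mk↔ₛ′; Equivalence)
open import Relation.Binary.Definitions using (DecidableEquality)
open import Relation.Binary.PropositionalEquality hiding ([_])
open import Relation.Nullary.Decidable
  using (Dec; toSum; does; dec-true; dec-false; yes; no; ¬?; decidable-stable; _×-dec_)
open import Relation.Nullary.Negation using (¬_)
open import Relation.Unary using (Decidable)
open import Defs

-- Lists without repetition

private variable
  X Y : Set
  xs ys zs : List X

∈-middle⁻ : ∀ {x y : X} as {bs} → x ∈ as ++ y ∷ bs → x ≢ y → x ∈ as ++ bs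
∈-middle⁻ as x∈ x≢y with ∈-++⁻ as x∈
... | inj₁ p         = ∈-++⁺ˡ p
... | inj₂ (here e)  = ⊥-elim (x≢y e)
... | inj₂ (there p) = ∈-++⁺ʳ as p

inhabited : 0 < length xs → ∃[ x ] x ∈ xs
inhabited {xs = x ∷ _} _ = x , here refl

-- The members of `xs` are cut out of `zs` one at a time; as `xs` has no repetition, those still to
-- come survive each cut.
complement : Unique xs → xs ⊆ zs → ∃[ ys ] zs ↭ xs ++ ys
complement {xs = []}     {zs = zs} _  _    = zs , ↭-refl
complement {xs = x ∷ xs} (x∉ ∷ u) xs⊆ with ∈-∃++ (xs⊆ (here refl))
... | as , bs , refl =
  let ys , p = complement u λ y∈ → ∈-middle⁻ as (xs⊆ (there y∈)) λ { refl → All.lookup x∉ y∈ refl }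
  in ys , ↭-trans (shift x as bs) (prep x p)

length-mono-⊆ : Unique xs → xs ⊆ zs → length xs ≤ length zs
length-mono-⊆ {xs = xs} u xs⊆ =
  let ys , p = complement u xs⊆
  in subst (length xs ≤_) (sym (trans (↭-length p) (length-++ xs))) (m≤m+n _ _)

length-concatMap-≤ : ∀ {B} (F : Y → List X) ys → (∀ {y} → y ∈ ys → length (F y) ≤ B) →
                     length (concatMap F ys) ≤ length ys * B
length-concatMap-≤ F []       _  = z≤n
length-concatMap-≤ {B = B} F (y ∷ ys) le =
  subst (_≤ B + length ys * B) (sym (length-++ (F y)))
        (+-mono-≤ (le (here refl)) (length-concatMap-≤ F ys (le ∘ there)))

length-≤-cover : ∀ {B} (F : Y → List X) → Unique xs →
                 (∀ {x} → x ∈ xs → ∃[ y ] y ∈ ys × x ∈ F y) →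
                 (∀ {y} → y ∈ ys → length (F y) ≤ B) → length xs ≤ length ys * B
length-≤-cover {ys = ys} F u cover le = ≤-trans
  (length-mono-⊆ u λ x∈ → let y , y∈ , x∈F = cover x∈ in ∈-concatMap⁺ F (Any.map (λ { refl → x∈F }) y∈))
  (length-concatMap-≤ F ys le)

length-≤-fibres : ∀ {B} (_≟_ : DecidableEquality Y) (f : X → Y) → Unique xs →
                  (∀ {x} → x ∈ xs → f x ∈ ys) →
                  (∀ {y} → y ∈ ys → length (filter (λ x → f x ≟ y) xs) ≤ B) →
                  length xs ≤ length ys * B
length-≤-fibres {xs = xs} _≟_ f u f∈ = length-≤-cover (λ y → filter (λ x → f x ≟ y) xs) u
  λ x∈ → _ , f∈ x∈ , ∈-filter⁺ _ x∈ refl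

-- The lists `F` for different `y` are disjoint because `f` separates them, so their concatenation
-- is a repetition-free part of `xs`.
length-≥-fibres : ∀ {B} (f : X → Y) → Unique ys →
                  (∀ {y} → y ∈ ys → ∃[ F ] Unique F × B ≤ length F × (∀ {x} → x ∈ F → x ∈ xs × f x ≡ y)) →
                  length ys * B ≤ length xs
length-≥-fibres {X = X} {Y = Y} {xs = xs} {B = B} f uys fibre =
  let F , uF , |F| , F⊆ = collect uys fibre in ≤-trans |F| (length-mono-⊆ uF (proj₁ ∘ F⊆))
  where
  collect : ∀ {ys : List Y} → Unique ys →
            (∀ {y} → y ∈ ys → ∃[ F ] Unique F × B ≤ length F × (∀ {x} → x ∈ F → x ∈ xs × f x ≡ y)) →
            ∃[ F ] Unique F × length ys * B ≤ length F × (∀ {x} → x ∈ F → x ∈ xs × f x ∈ ys)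
  collect []       _   = [] , [] , z≤n , λ ()
  collect {ys = y ∷ ys} (y∉ ∷ u) fib =
    let F , uF , |F| , F⊆ = fib (here refl)
        E , uE , |E| , E⊆ = collect u (fib ∘ there)
    in F ++ E
     , Unique.++⁺ uF uE (λ (x∈F , x∈E) → All.lookup y∉ (proj₂ (E⊆ x∈E)) (sym (proj₂ (F⊆ x∈F))))
     , subst (B + length ys * B ≤_) (sym (length-++ F)) (+-mono-≤ |F| |E|)
     , λ x∈ → case x∈ F⊆ E⊆
    where
    case : ∀ {F E : List X} {x} → x ∈ F ++ E → (∀ {x} → x ∈ F → x ∈ xs × f x ≡ y) →
           (∀ {x} → x ∈ E → x ∈ xs × f x ∈ ys) → x ∈ xs × f x ∈ y ∷ ys
    case {F} x∈ F⊆ E⊆ with ∈-++⁻ F x∈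
    ... | inj₁ x∈F = proj₁ (F⊆ x∈F) , here (proj₂ (F⊆ x∈F))
    ... | inj₂ x∈E = proj₁ (E⊆ x∈E) , there (proj₂ (E⊆ x∈E))

length-filter-split : ∀ {P : X → Set} (P? : Decidable P) xs →
                      length xs ≡ length (filter P? xs) + length (filter (¬? ∘ P?) xs)
length-filter-split P? []       = refl
length-filter-split P? (x ∷ xs) with P? x
... | yes _ = cong suc (length-filter-split P? xs)
... | no  _ = trans (cong suc (length-filter-split P? xs)) (sym (+-suc _ _))

take-⊆ : ∀ k → take k xs ⊆ xs
take-⊆ {xs = x ∷ xs} (suc k) (here e)  = here e
take-⊆ {xs = x ∷ xs} (suc k) (there p) = there (take-⊆ k p)

length-take-≤ : ∀ {k} → k ≤ length xs → length (take k xs) ≡ k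
length-take-≤ {xs = xs} {k} k≤ = trans (length-take k xs) (m≤n⇒m⊓n≡m k≤)

length-cartesianProductWith : ∀ {Z : Set} (f : X → Y → Z) xs ys →
                              length (cartesianProductWith f xs ys) ≡ length xs * length ys
length-cartesianProductWith f []       ys = refl
length-cartesianProductWith f (x ∷ xs) ys = trans (length-++ (map (f x) ys))
  (cong₂ _+_ (length-map (f x) ys) (length-cartesianProductWith f xs ys))

vecsOver : List X → ∀ n → List (Vec X n)
vecsOver cs zero    = [ [] ]
vecsOver cs (suc n) = cartesianProductWith _∷_ cs (vecsOver cs n)

vecsOver-unique : Unique xs → ∀ n → Unique (vecsOver xs n)
vecsOver-unique u zero    = All.[] ∷ []
vecsOver-unique u (suc n) = Unique.cartesianProductWith⁺ _∷_ ∷-injective u (vecsOver-unique u n)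

length-vecsOver : ∀ (xs : List X) n → length (vecsOver xs n) ≡ length xs ^ n
length-vecsOver xs zero    = refl
length-vecsOver xs (suc n) = trans (length-cartesianProductWith _∷_ xs _) (cong (length xs *_) (length-vecsOver xs n))

∈-vecsOver⁻ : ∀ {n} {v : Vec X n} → v ∈ vecsOver xs n → ∀ i → lookup v i ∈ xs
∈-vecsOver⁻ {xs = xs} {n = suc n} v∈ i with ∈-cartesianProductWith⁻ _∷_ xs (vecsOver xs n) v∈ | i
... | _ , _ , a∈ , _  , refl | zero  = a∈
... | _ , _ , _  , b∈ , refl | suc j = ∈-vecsOver⁻ b∈ j

∈-vecsOver⁺ : ∀ {n} (v : Vec X n) → (∀ i → lookup v i ∈ xs) → v ∈ vecsOver xs n
∈-vecsOver⁺ []      _  = here refl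
∈-vecsOver⁺ (x ∷ v) v∈ = ∈-cartesianProductWith⁺ _∷_ (v∈ zero) (∈-vecsOver⁺ v (v∈ ∘ suc))

allMaps≡vecsOver : ∀ n m → allMaps n m ≡ vecsOver (allFin m) n
allMaps≡vecsOver zero    m = refl
allMaps≡vecsOver (suc n) m = cong (cartesianProductWith _∷_ (allFin m)) (allMaps≡vecsOver n m)

allMaps-unique : ∀ n m → Unique (allMaps n m)
allMaps-unique n m = subst Unique (sym (allMaps≡vecsOver n m)) (vecsOver-unique (Unique.allFin⁺ m) n)

∈-allMaps : ∀ {n m} (f : Vec (Fin m) n) → f ∈ allMaps n m
∈-allMaps f = subst (f ∈_) (sym (allMaps≡vecsOver _ _)) (∈-vecsOver⁺ f λ _ → ∈-allFin _)

length-allFin : ∀ n → length (allFin n) ≡ n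
length-allFin n = length-tabulate {n = n} λ i → i

length-allMaps : ∀ n m → length (allMaps n m) ≡ m ^ n
length-allMaps n m = trans (cong length (allMaps≡vecsOver n m))
  (trans (length-vecsOver (allFin m) n) (cong (_^ n) (length-allFin m)))

Unique-resp-↭ : ∀ {X : Set} {xs ys : List X} → xs ↭ ys → Unique xs → Unique ys
Unique-resp-↭ p = PermSetoid.Unique-resp-↭ (setoid _) (↭⇒↭ₛ p)

Unique-++⁻ʳ : ∀ {X : Set} (xs : List X) {ys} → Unique (xs ++ ys) → Unique ys
Unique-++⁻ʳ []       u       = u
Unique-++⁻ʳ (x ∷ xs) (_ ∷ u) = Unique-++⁻ʳ xs u

lookup-injective : ∀ {X : Set} {k} {V : Vec X k} → Unique (toList V) → ∀ {i j} → lookup V i ≡ lookup V j → i ≡ j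
lookup-injective {V = _ ∷ _} _        {zero}  {zero}  _  = refl
lookup-injective {V = _ ∷ V} (x∉ ∷ _) {zero}  {suc j} eq = ⊥-elim (All.lookup x∉ (∈-toList⁺ (∈ᵥ-lookup j V)) eq)
lookup-injective {V = _ ∷ V} (x∉ ∷ _) {suc i} {zero}  eq = ⊥-elim (All.lookup x∉ (∈-toList⁺ (∈ᵥ-lookup i V)) (sym eq))
lookup-injective {V = _ ∷ _} (_ ∷ u)  {suc i} {suc j} eq = cong suc (lookup-injective u eq)

-- A nonempty remainder of `zs` after removing `xs` would make `zs` the longer list.
⊆-reverse : ∀ {X : Set} {xs zs : List X} → Unique xs → xs ⊆ zs → length zs ≤ length xs → zs ⊆ xs
⊆-reverse {xs = xs} u xs⊆ le z∈ with complement u xs⊆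
... | [] , p     = fromInj₁ (λ ()) (∈-++⁻ xs (∈-resp-↭ p z∈))
... | y ∷ ys , p = ⊥-elim (<⇒≱ (m<m+n (length xs) z<s)
                     (subst (_≤ length xs) (trans (↭-length p) (length-++ xs)) le))

lookup-ext : ∀ {X : Set} {n} {f g : Vec X n} → (∀ i → lookup f i ≡ lookup g i) → f ≡ g
lookup-ext {f = f} {g} eq = trans (sym (tabulate∘lookup f)) (trans (tabulate-cong eq) (tabulate∘lookup g))

flatten : ∀ {X : Set} → List (X × X) → List X
flatten []            = []
flatten ((x , y) ∷ M) = x ∷ y ∷ flatten M

length-flatten : ∀ {X : Set} (M : List (X × X)) → length (flatten M) ≡ 2 * length M
length-flatten []      = refl
length-flatten (_ ∷ M) = trans (cong (2 +_) (length-flatten M)) (sym (*-suc 2 (length M)))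

+-pigeonhole : ∀ {a y z} → a + a ≤ y + z → a ≤ y ⊎ a ≤ z
+-pigeonhole {a} {y} {z} le with a ≤? y | a ≤? z
... | yes a≤y | _       = inj₁ a≤y
... | no  _   | yes a≤z = inj₂ a≤z
... | no  a≰y | no  a≰z = ⊥-elim (<⇒≱ (+-mono-< (≰⇒> a≰y) (≰⇒> a≰z)) le)

-- Pigeonhole, one `c` of `C` at a time: `I` splits into members related to `c` and members not
-- related to it, and one class keeps at least half of the required size. All survivors have the
-- same trace on `C`.
common-trace : ∀ {X Y : Set} {_R_ : X → Y → Set} (R? : ∀ x y → Dec (x R y)) C {I L} → Unique I →
               2 ^ length C * L ≤ length I →
               ∃[ A ] ∃[ N ] Unique N × N ⊆ I × L ≤ length N × (∀ {x} → x ∈ N → filter (R? x) C ≡ A)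
common-trace R? []      {I} uI le = [] , I , uI , (λ {x} x∈ → x∈) , ≤-trans (≤-reflexive (sym (+-identityʳ _))) le , λ _ → refl
common-trace {X = X} R? (c ∷ C) {I} {L} uI le =
  [ (λ le → let A , N , uN , N⊆ , |N| , trace = common-trace R? C (Unique.filter⁺ near? uI) le
            in c ∷ A , N , uN , (λ {x} x∈ → filter-⊆ near? I (N⊆ x∈)) , |N|
             , λ {x} x∈ → trans (filter-accept (R? x) (proj₂ (∈-filter⁻ near? {xs = I} (N⊆ x∈)))) (cong (c ∷_) (trace x∈)))
  , (λ le → let A , N , uN , N⊆ , |N| , trace = common-trace R? C (Unique.filter⁺ far? uI) le
            in A , N , uN , (λ {x} x∈ → filter-⊆ far? I (N⊆ x∈)) , |N|
             , λ {x} x∈ → trans (filter-reject (R? x) (proj₂ (∈-filter⁻ far? {xs = I} (N⊆ x∈)))) (trace x∈))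
  ]′ (+-pigeonhole (subst₂ _≤_ double (length-filter-split near? I) le))
  where
  near? = λ x → R? x c
  far?  = ¬? ∘ near?
  double : 2 ^ suc (length C) * L ≡ 2 ^ length C * L + 2 ^ length C * L
  double = solve 2 (λ p l → (p :+ (p :+ con 0)) :* l := p :* l :+ p :* l) refl (2 ^ length C) L
    where open +-*-Solver

choose : ∀ {X : Set} {xs : List X} {k} → Unique xs → k ≤ length xs →
         ∃[ W ] Unique (toList {n = k} W) × toList W ⊆ xs
choose {xs = xs} {k} u k≤ = asVec (length-take-≤ k≤) (Unique.take⁺ k u) (take-⊆ k)
  where
  asVec : ∀ {ys k} → length ys ≡ k → Unique ys → ys ⊆ xs → ∃[ W ] Unique (toList {n = k} W) × toList W ⊆ xs
  asVec {ys} refl u ys⊆ = fromList ys , subst Unique (sym (toList∘fromList ys)) u , subst (_⊆ xs) (sym (toList∘fromList ys)) ys⊆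

Unique-++⁻ˡ : ∀ {X : Set} (xs : List X) {ys} → Unique (xs ++ ys) → Unique xs
Unique-++⁻ˡ []       _        = []
Unique-++⁻ˡ (x ∷ xs) (x∉ ∷ u) = ++⁻ˡ xs x∉ ∷ Unique-++⁻ˡ xs u

Unique-++⇒disjoint : ∀ {X : Set} (xs : List X) {ys v} → Unique (xs ++ ys) → v ∈ xs → v ∉ ys
Unique-++⇒disjoint (x ∷ xs) (x∉ ∷ _) (here refl) v∈ys = All.lookup x∉ (∈-++⁺ʳ xs v∈ys) refl
Unique-++⇒disjoint (x ∷ xs) (_ ∷ u)  (there v∈)  v∈ys = Unique-++⇒disjoint xs u v∈ v∈ys

-- Powers

^-distribʳ-* : ∀ a b n → (a * b) ^ n ≡ a ^ n * b ^ n
^-distribʳ-* a b zero    = refl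
^-distribʳ-* a b (suc n) = trans (cong (a * b *_) (^-distribʳ-* a b n))
  (solve 4 (λ a b x y → a :* b :* (x :* y) := a :* x :* (b :* y)) refl a b (a ^ n) (b ^ n))
  where open +-*-Solver

-- Bernoulli's inequality `1 + k / a ≤ (1 + 1 / a) ^ k`, cleared of denominators.
bernoulli : ∀ a k → a ^ k * (a + k) ≤ suc a ^ k * a
bernoulli a zero    = ≤-reflexive (cong (_+ 0) (+-identityʳ a))
bernoulli a (suc k) = begin
  -- The added `p * k` is exactly what lets the factor `suc a` split off.
  a * p * (a + suc k)             ≤⟨ m≤m+n _ (p * k) ⟩
  a * p * (a + suc k) + p * k     ≡⟨ solve 3 (λ a k p → a :* p :* (a :+ (con 1 :+ k)) :+ p :* k
                                                     := (con 1 :+ a) :* (p :* (a :+ k))) refl a k p ⟩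
  suc a * (p * (a + k))           ≤⟨ *-monoʳ-≤ (suc a) (bernoulli a k) ⟩
  suc a * (suc a ^ k * a)         ≡⟨ *-assoc (suc a) (suc a ^ k) a ⟨
  suc a ^ suc k * a               ∎
  where
  open ≤-Reasoning
  open +-*-Solver
  p = a ^ k

exponential-gap : ∀ {a b} → a < b → ∀ c → ∃[ k ] a ^ suc k * c < b ^ suc k
exponential-gap {zero}  {suc b} _   c = 0 , s≤s z≤n
-- The exponent `K` exceeds `suc a * c`, so Bernoulli's bound `1 + K / suc a` for the `K`-th power
-- of the ratio `suc (suc a) / suc a` exceeds `c`; and `b` is at least `suc (suc a)`.
exponential-gap {suc a} {b}     a<b c = suc a * c , <-≤-trans
  (*-cancelʳ-< (suc a) _ _ (begin-strict
    p * c * suc a              ≡⟨ solve 3 (λ p c a → p :* c :* a := p :* (a :* c)) refl p c (suc a) ⟩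
    p * (suc a * c)            <⟨ *-monoʳ-< p ⦃ m^n≢0 (suc a) K ⦄ (≤-trans (≤-refl {K}) (m≤n+m K (suc a))) ⟩
    p * (suc a + K)            ≤⟨ bernoulli (suc a) K ⟩
    suc (suc a) ^ K * suc a    ∎))
  (^-monoˡ-≤ K a<b)
  where
  open ≤-Reasoning
  open +-*-Solver
  K = suc (suc a * c)
  p = suc a ^ K

n≤2^n : ∀ n → n ≤ 2 ^ n
n≤2^n zero    = z≤n
n≤2^n (suc n) = +-mono-≤ (m^n>0 2 n) (≤-trans (n≤2^n n) (m≤m+n _ 0))

m≤m^n : ∀ m {n} → 1 ≤ n → m ≤ m ^ n
m≤m^n zero    _         = z≤n
m≤m^n (suc m) {suc n} _ = m≤m*n (suc m) (suc m ^ n) ⦃ m^n≢0 (suc m) n ⦄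

^-pos : ∀ {Δ} → 0 < Δ → ∀ k → NonZero (Δ ^ k)
^-pos {suc d} _ k = m^n≢0 (suc d) k

-- Every factor is absorbed into a `δ`-th power with base free of `δ`: `2 ^ (2 * (κ * δ))` is one
-- already, `2 * κ + ℓ` is at most its own `δ`-th power, and `δ ≤ 2 ^ δ`. The left side is the order
-- that pigeonhole over traces on a cover of `2 * (κ * δ)` vertices asks for.
exponential-threshold : ∀ κ ℓ {δ} → 1 ≤ δ →
  2 * (κ * δ) + 2 ^ (2 * (κ * δ)) * (ℓ * δ) ≤ (2 ^ (2 * κ) * ((2 * κ + ℓ) * 2)) ^ δ
exponential-threshold κ ℓ {δ} 1≤δ = begin
  2 * (κ * δ) + 2 ^ (2 * (κ * δ)) * (ℓ * δ)   ≡⟨ cong₂ (λ x y → x + y * (ℓ * δ)) (sym (*-assoc 2 κ δ))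
                                                   (trans (cong (2 ^_) (sym (*-assoc 2 κ δ))) (sym (^-*-assoc 2 (2 * κ) δ))) ⟩
  2 * κ * δ + a ^ δ * (ℓ * δ)                 ≤⟨ +-monoˡ-≤ _ (m≤n*m (2 * κ * δ) (a ^ δ) ⦃ m^n≢0 a δ ⦃ m^n≢0 2 (2 * κ) ⦄ ⦄) ⟩
  a ^ δ * (2 * κ * δ) + a ^ δ * (ℓ * δ)       ≡⟨ *-distribˡ-+ (a ^ δ) _ _ ⟨
  a ^ δ * (2 * κ * δ + ℓ * δ)                 ≡⟨ cong (a ^ δ *_) (*-distribʳ-+ δ (2 * κ) ℓ) ⟨
  a ^ δ * (d * δ)                             ≤⟨ *-monoʳ-≤ (a ^ δ) (*-mono-≤ (m≤m^n d 1≤δ) (n≤2^n δ)) ⟩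
  a ^ δ * (d ^ δ * 2 ^ δ)                     ≡⟨ cong (a ^ δ *_) (^-distribʳ-* d 2 δ) ⟨
  a ^ δ * (d * 2) ^ δ                         ≡⟨ ^-distribʳ-* a (d * 2) δ ⟨
  (a * (d * 2)) ^ δ                           ∎
  where
  open ≤-Reasoning
  a = 2 ^ (2 * κ)
  d = 2 * κ + ℓ

-- The `suc` in the constant gives the strict inequality that the count in `enough-popular`
-- contradicts.
quadratic-threshold : ∀ κ ℓ {δ} → 1 ≤ δ →
  2 * (κ * δ) + 2 * (κ * δ) * (ℓ * δ) < suc (2 * κ + 2 * κ * ℓ) * δ ^ 2
quadratic-threshold κ ℓ {δ} 1≤δ = begin-strict
  2 * (κ * δ) + 2 * (κ * δ) * (ℓ * δ)       ≤⟨ +-monoˡ-≤ _ (*-monoʳ-≤ 2 (*-monoʳ-≤ κ (m≤m^n δ {2} z<s))) ⟩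
  2 * (κ * δ ^ 2) + 2 * (κ * δ) * (ℓ * δ)   ≡⟨ solve 3 (λ κ ℓ δ → con 2 :* (κ :* (δ :* (δ :* con 1))) :+
                                                   con 2 :* (κ :* δ) :* (ℓ :* δ) := (con 2 :* κ :+ con 2 :* κ :* ℓ) :* (δ :* (δ :* con 1))) refl κ ℓ δ ⟩
  (2 * κ + 2 * κ * ℓ) * δ ^ 2               <⟨ *-monoˡ-< (δ ^ 2) ⦃ m^n≢0 δ 2 ⦃ >-nonZero 1≤δ ⦄ ⦄ (n<1+n (2 * κ + 2 * κ * ℓ)) ⟩
  suc (2 * κ + 2 * κ * ℓ) * δ ^ 2           ∎
  where
  open ≤-Reasoning
  open +-*-Solver

-- Neighbours and homomorphisms

neighbours : ∀ {m} → Graph m → Fin m → List (Fin m)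
neighbours H c = filter (c ~?_) (allFin _)
  where open Graph H

∈-neighbours⁺ : ∀ {m} (H : Graph m) {c d} → Graph._~_ H c d → d ∈ neighbours H c
∈-neighbours⁺ H {c} e = ∈-filter⁺ (Graph._~?_ H c) (∈-allFin _) e

∈-neighbours⁻ : ∀ {m} (H : Graph m) {c d} → d ∈ neighbours H c → Graph._~_ H c d
∈-neighbours⁻ H {c} d∈ = proj₂ (∈-filter⁻ (Graph._~?_ H c) {xs = allFin _} d∈)

min-degree⇒NoIsolated : ∀ {n} (G : Graph n) {δ} → 1 ≤ δ → (∀ v → δ ≤ degree G v) → NoIsolated G
min-degree⇒NoIsolated G 1≤δ min-degree v =
  let w , w∈ = inhabited (≤-trans 1≤δ (min-degree v)) in w , ∈-neighbours⁻ G w∈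

neighbours-unique : ∀ {m} (H : Graph m) c → Unique (neighbours H c)
neighbours-unique H c = Unique.filter⁺ (Graph._~?_ H c) (Unique.allFin⁺ _)

degree≤maxDegree : ∀ {m} (H : Graph m) c → degree H c ≤ maxDegree H
degree≤maxDegree H c = All.lookup (xs≤max 0 (map (degree H) (allFin _))) (∈-map⁺ (degree H) (∈-allFin c))

maxDegree-attained : ∀ {m} (H : Graph m) → 0 < maxDegree H → ∃[ x ] degree H x ≡ maxDegree H
maxDegree-attained H 0<Δ with argmax-sel (λ k → k) 0 (map (degree H) (allFin _))
... | inj₁ Δ≡0 = ⊥-elim (>⇒≢ 0<Δ Δ≡0)
... | inj₂ Δ∈  = let x , _ , e = ∈-map⁻ (degree H) Δ∈ in x , sym e

maxDegree-positive : ∀ {m} (H : Graph m) {k} → k < maxDegree H ^ 2 → 0 < maxDegree H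
maxDegree-positive H {k} k<Δ² = n≢0⇒n>0 λ Δ≡0 → n≮0 (subst (λ d → k < d ^ 2) Δ≡0 k<Δ²)

-- Ordered pairs read off from the homomorphisms of `K₂`, so that their number is `hom K₂ H`: two
-- pairs for an edge between distinct vertices, one for a loop.
edges : ∀ {m} → Graph m → List (Fin m × Fin m)
edges {m} H = map (λ f → lookup f zero , lookup f (suc zero)) (filter (isHom? K₂ H) (allMaps 2 m))

length-edges : ∀ {m} (H : Graph m) → length (edges H) ≡ hom K₂ H
length-edges {m} H = length-map _ (filter (isHom? K₂ H) (allMaps 2 m))

∈-edges : ∀ {m} (H : Graph m) {c d} → Graph._~_ H c d → (c , d) ∈ edges H
∈-edges {m} H {c} {d} e = ∈-map⁺ _ (∈-filter⁺ (isHom? K₂ H) (∈-allMaps (c ∷ d ∷ [])) isHom)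
  where
  isHom : IsHom K₂ H (c ∷ d ∷ [])
  isHom zero       zero       ne = ⊥-elim (ne refl)
  isHom zero       (suc zero) _  = e
  isHom (suc zero) zero       _  = Graph.~-sym H e
  isHom (suc zero) (suc zero) ne = ⊥-elim (ne refl)

-- A looped clique on the neighbours of x would contain (degree H x)² edges.
neighbours-not-clique : ∀ {m} (H : Graph m) → let open Graph H in ∀ {x} → hom K₂ H < degree H x ^ 2 →
                        ∃[ a ] ∃[ b ] x ~ a × x ~ b × ¬ a ~ b
neighbours-not-clique H {x} few
  with any? (λ a → any? λ b → (x ~? a) ×-dec (x ~? b) ×-dec ¬? (a ~? b))
  where open Graph H
... | yes found = found
... | no  none  = ⊥-elim (<⇒≱ few (begin
    degree H x ^ 2                   ≡⟨ cong (degree H x *_) (*-identityʳ _) ⟩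
    degree H x * degree H x          ≡⟨ length-cartesianProductWith _,_ N N ⟨
    length (cartesianProduct N N)    ≤⟨ length-mono-⊆ (Unique.cartesianProduct⁺ uN uN) clique ⟩
    length (edges H)                 ≡⟨ length-edges H ⟩
    hom K₂ H                         ∎))
  where
  open Graph H
  open ≤-Reasoning
  N = neighbours H x
  uN = neighbours-unique H x
  clique : cartesianProduct N N ⊆ edges H
  clique {a , b} ab∈ =
    let a∈ , b∈ = ∈-cartesianProduct⁻ N N ab∈
    in ∈-edges H (decidable-stable (a ~? b) λ a≁b →
         none (a , b , ∈-neighbours⁻ H a∈ , ∈-neighbours⁻ H b∈ , a≁b))

homs : ∀ {n m} → SimpleGraph n → Graph m → List (Vec (Fin m) n)
homs G H = filter (isHom? G H) (allMaps _ _)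

homs-unique : ∀ {n m} (G : SimpleGraph n) (H : Graph m) → Unique (homs G H)
homs-unique G H = Unique.filter⁺ (isHom? G H) (allMaps-unique _ _)

∈-homs⁺ : ∀ {n m} (G : SimpleGraph n) (H : Graph m) {f} → IsHom G H f → f ∈ homs G H
∈-homs⁺ G H = ∈-filter⁺ (isHom? G H) (∈-allMaps _)

∈-homs⁻ : ∀ {n m} (G : SimpleGraph n) (H : Graph m) {f} → f ∈ homs G H → IsHom G H f
∈-homs⁻ G H f∈ = proj₂ (∈-filter⁻ (isHom? G H) {xs = allMaps _ _} f∈)

-- Extensions of partial colourings

module Extension {n m} (G : SimpleGraph n) (H : Graph m)
                 (nonisolated : NoIsolated (SimpleGraph.graph G))
                 (few : hom K₂ H ≤ maxDegree H ^ 2) where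
  private
    module G = SimpleGraph G
    module H = Graph H
    Δ = maxDegree H
    h = hom K₂ H

  record Family (xs : List (Vec (Fin m) n)) : Set where
    constructor family
    field
      unique : Unique xs
      isHom  : ∀ {f} → f ∈ xs → IsHom G H f
  open Family

  -- A partial colouring is represented by a list of homomorphisms extending it; its coloured
  -- vertices are those on which the whole list agrees. Colouring further vertices means passing to
  -- sublists.
  Determined : List (Vec (Fin m) n) → Fin n → Set
  Determined xs v = ∀ {f g} → f ∈ xs → g ∈ xs → lookup f v ≡ lookup g v

  homsFamily : Family (homs G H)
  homsFamily = family (homs-unique G H) (∈-homs⁻ G H)

  Covers : List (Vec (Fin m) n) → List (Fin n) → Set
  Covers xs us = ∀ v → Determined xs v ⊎ v ∈ us

  FewColours : List (Vec (Fin m) n) → ℕ → Fin n → Set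
  FewColours xs B v = ∃[ cs ] length cs ≤ B × (∀ {f} → f ∈ xs → lookup f v ∈ cs)

  covers-⊆ : ∀ {xs us vs} → us ⊆ vs → Covers xs us → Covers xs vs
  covers-⊆ us⊆vs cov v with cov v
  ... | inj₁ d  = inj₁ d
  ... | inj₂ v∈ = inj₂ (us⊆vs v∈)

  covers-tail : ∀ {xs ys u us} → ys ⊆ xs → Determined ys u → Covers xs (u ∷ us) → Covers ys us
  covers-tail ys⊆ det cov v with cov v
  ... | inj₁ d           = inj₁ λ f∈ g∈ → d (ys⊆ f∈) (ys⊆ g∈)
  ... | inj₂ (here refl) = inj₁ det
  ... | inj₂ (there v∈)  = inj₂ v∈

  restrict : ∀ {P : Vec (Fin m) n → Set} (P? : Decidable P) {xs} → Family xs → Family (filter P? xs)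
  restrict P? 𝓕 = family (Unique.filter⁺ P? (unique 𝓕)) (isHom 𝓕 ∘ proj₁ ∘ ∈-filter⁻ P?)

  branch : ∀ {Y : Set} (_≟_ : DecidableEquality Y) (t : Vec (Fin m) n → Y) {xs cs B} →
           Family xs → (∀ {f} → f ∈ xs → t f ∈ cs) →
           (∀ {ys c} → c ∈ cs → ys ⊆ xs → Family ys → (∀ {f} → f ∈ ys → t f ≡ c) → length ys ≤ B) →
           length xs ≤ length cs * B
  branch _≟_ t {xs} 𝓕 t∈ le = length-≤-fibres _≟_ t (unique 𝓕) t∈ λ {c} c∈ →
    le c∈ (λ f∈ → proj₁ (∈-filter⁻ (λ f → t f ≟ c) f∈)) (restrict (λ f → t f ≟ c) 𝓕)
       (λ f∈ → proj₂ (∈-filter⁻ (λ f → t f ≟ c) {xs = xs} f∈))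

  colour-vertex : ∀ {xs u cs B} → Family xs → (∀ {f} → f ∈ xs → lookup f u ∈ cs) →
                  (∀ {ys} → ys ⊆ xs → Family ys → Determined ys u → length ys ≤ B) →
                  length xs ≤ length cs * B
  colour-vertex {u = u} 𝓕 in-cs le = branch _≟_ (λ f → lookup f u) 𝓕 in-cs
    λ _ ys⊆ 𝓖 eq → le ys⊆ 𝓖 λ f∈ g∈ → trans (eq f∈) (sym (eq g∈))

  -- The colours at `u` and `v` form an ordered edge of `H`, so the two vertices together branch in
  -- at most `h` ways, whether or not any neighbour is coloured already.
  colour-edge : ∀ {xs u v us B} → Family xs → u G.~ v → Covers xs (u ∷ v ∷ us) →
                (∀ {ys} → Family ys → Covers ys us → length ys ≤ B) → length xs ≤ h * B
  colour-edge {xs} {u} {v} {us} {B} 𝓕 e cov le = subst (λ k → length xs ≤ k * B) (length-edges H)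
    (branch (≡-dec _≟_ _≟_) (λ f → lookup f u , lookup f v) 𝓕 (λ f∈ → ∈-edges H (isHom 𝓕 f∈ u v e))
      λ _ ys⊆ 𝓖 eq →
        let same : ∀ {f g} → f ∈ _ → g ∈ _ → (lookup f u , lookup f v) ≡ (lookup g u , lookup g v)
            same f∈ g∈ = trans (eq f∈) (sym (eq g∈))
        in le 𝓖 (covers-tail (λ f∈ → f∈) (λ f∈ g∈ → cong proj₂ (same f∈ g∈))
                   (covers-tail ys⊆ (λ f∈ g∈ → cong proj₁ (same f∈ g∈)) cov)))

  -- Take a neighbour `w` of the first uncoloured `u`. If `w` is coloured, `u` has at most `Δ`
  -- choices; otherwise `u` and `w` are coloured together in at most `h ≤ Δ ^ 2` ways. The recursion
  -- runs on the length `k`, because `as ++ bs` is not a structural part of `us`.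
  extend : ∀ {xs} k us → length us ≡ k → Family xs → Covers xs us → length xs ≤ Δ ^ k
  extend {[]}         k       us       _    𝓕 cov = z≤n
  extend {_ ∷ []}     zero    []       _    𝓕 cov = ≤-refl
  -- With no vertex left to colour, two members of the list agree everywhere, against uniqueness.
  extend {f ∷ g ∷ xs} zero    []       _    𝓕 cov =
    ⊥-elim (All.head (AllPairs.head (unique 𝓕)) (lookup-ext λ v → agree v (cov v)))
    where
    agree : ∀ v → Determined (f ∷ g ∷ xs) v ⊎ v ∈ [] → lookup f v ≡ lookup g v
    agree v (inj₁ d) = d (here refl) (there (here refl))
  extend {f₀ ∷ _} (suc k) (u ∷ us) eq 𝓕 cov with nonisolated u
  ... | w , u~w with cov w
  ... | inj₁ w-det = ≤-trans
    (colour-vertex 𝓕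
      (λ {f} f∈ → ∈-neighbours⁺ H (subst (H._~ lookup f u) (w-det f∈ (here refl)) (isHom 𝓕 f∈ w u (G.~-sym u~w))))
      (λ ys⊆ 𝓖 det → extend k us (suc-injective eq) 𝓖 (covers-tail ys⊆ det cov)))
    (*-monoˡ-≤ (Δ ^ k) (degree≤maxDegree H (lookup f₀ w)))
  ... | inj₂ (here refl) = ⊥-elim (G.loopless refl u~w)
  ... | inj₂ (there w∈) with ∈-∃++ w∈
  extend {f₀ ∷ _} (suc zero) (u ∷ us) eq 𝓕 cov | w , u~w | inj₂ (there w∈) | as , bs , refl
    with () ← trans (sym (length-++-sucʳ as w bs)) (suc-injective eq)
  extend {f₀ ∷ xs} (suc (suc k)) (u ∷ us) eq 𝓕 cov | w , u~w | inj₂ (there w∈) | as , bs , refl = begin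
    length (f₀ ∷ xs)  ≤⟨ colour-edge 𝓕 u~w (covers-⊆ (∈-resp-↭ (prep u (shift w as bs))) cov)
                           (extend k (as ++ bs) (suc-injective (trans (sym (length-++-sucʳ as w bs)) (suc-injective eq)))) ⟩
    h * Δ ^ k         ≤⟨ *-monoˡ-≤ (Δ ^ k) few ⟩
    Δ ^ 2 * Δ ^ k     ≡⟨ ^-distribˡ-+-* Δ 2 k ⟨
    Δ ^ suc (suc k)   ∎
    where open ≤-Reasoning

  -- The edges of `M` are coloured first, so that each contributes its factor `h` before `extend`
  -- treats the remaining vertices.
  extend-matching : ∀ {xs} M us → All (λ (u , v) → u G.~ v) M → Family xs → Covers xs (flatten M ++ us) →
                    length xs ≤ h ^ length M * Δ ^ length us
  extend-matching []            us []      𝓕 cov =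
    ≤-trans (extend (length us) us refl 𝓕 cov) (≤-reflexive (sym (*-identityˡ _)))
  extend-matching ((u , v) ∷ M) us (e ∷ es) 𝓕 cov = ≤-trans
    (colour-edge 𝓕 e cov (extend-matching M us es))
    (≤-reflexive (sym (*-assoc h (h ^ length M) _)))

  extend-restricted : ∀ {xs B} N us → All (FewColours xs B) N → Family xs → Covers xs (N ++ us) →
                      length xs ≤ B ^ length N * Δ ^ length us
  extend-restricted []      us [] 𝓕 cov =
    ≤-trans (extend (length us) us refl 𝓕 cov) (≤-reflexive (sym (*-identityˡ _)))
  extend-restricted {B = B} (v ∷ N) us ((cs , |cs|≤B , in-cs) ∷ few-colours) 𝓕 cov = ≤-trans
    (colour-vertex 𝓕 in-cs λ ys⊆ 𝓖 det → extend-restricted N us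
      (All.map (λ (cs , le , in-cs) → cs , le , λ {f} f∈ → in-cs (ys⊆ f∈)) few-colours)
      𝓖 (covers-tail ys⊆ det cov))
    (≤-trans (*-monoˡ-≤ _ |cs|≤B) (≤-reflexive (sym (*-assoc B (B ^ length N) _))))

  colour-vertices : ∀ {δ} (W : Vec (Fin n) δ) {xs gs B} → Family xs → (∀ {f} → f ∈ xs → Vec.map (lookup f) W ∈ gs) →
                    (∀ {ys g} → g ∈ gs → ys ⊆ xs → Family ys →
                       (∀ {f} → f ∈ ys → ∀ i → lookup f (lookup W i) ≡ lookup g i) → length ys ≤ B) →
                    length xs ≤ length gs * B
  colour-vertices W 𝓕 in-gs le = branch (Vec≡-dec _≟_) (λ f → Vec.map (lookup f) W) 𝓕 in-gs
    λ g∈ ys⊆ 𝓖 eq → le g∈ ys⊆ 𝓖 λ {f} f∈ i →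
      trans (sym (lookup-map i (lookup f) W)) (cong (λ v → lookup v i) (eq f∈))

-- Comparison with complete bipartite graphs

adjacent-pair? : ∀ {n} (G : SimpleGraph n) → let open SimpleGraph G in ∀ us → Unique us →
                 (∃[ u ] ∃[ v ] ∃[ us′ ] u ~ v × us ↭ u ∷ v ∷ us′) ⊎ (∀ {u v} → u ∈ us → v ∈ us → ¬ u ~ v)
adjacent-pair? G us uniq with Any.any? (λ u → Any.any? (SimpleGraph._~?_ G u) us) us
... | no none = inj₂ λ u∈ v∈ e → none (lose u∈ (lose v∈ e))
... | yes p with find p
... | u , u∈ , q with find q
... | v , v∈ , e =
  let us′ , us↭ = complement ((u≢v ∷ []) ∷ [] ∷ []) λ { (here refl) → u∈ ; (there (here refl)) → v∈ }
  in inj₁ (u , v , us′ , e , us↭)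
  where
  u≢v : u ≢ v
  u≢v eq = SimpleGraph.loopless G eq e

commonNeighbours : ∀ {m δ} → Graph m → Vec (Fin m) δ → List (Fin m)
commonNeighbours H g = filter (λ c → all? λ i → lookup g i ~? c) (allFin _)
  where open Graph H

-- For `δ ≥ 1` the common neighbours lie among the neighbours of one entry, so there are never more
-- than `Δ`, and the inequality is then an equality.
Full : ∀ {m δ} → Graph m → Vec (Fin m) δ → Set
Full H g = maxDegree H ≤ length (commonNeighbours H g)

full? : ∀ {m δ} (H : Graph m) → Decidable (Full {m} {δ} H)
full? H g = maxDegree H ≤? length (commonNeighbours H g)

fullVecs : ∀ {m} → Graph m → ∀ δ → List (Vec (Fin m) δ)
fullVecs H δ = filter (full? H) (allMaps δ _)

∈-commonNeighbours⁻ : ∀ {m δ} (H : Graph m) {g : Vec (Fin m) δ} {c} → c ∈ commonNeighbours H g →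
                      ∀ i → Graph._~_ H (lookup g i) c
∈-commonNeighbours⁻ H {g} c∈ =
  proj₂ (∈-filter⁻ (λ c → all? λ i → Graph._~?_ H (lookup g i) c) {xs = allFin _} c∈)

∈-commonNeighbours⁺ : ∀ {m δ} (H : Graph m) {g : Vec (Fin m) δ} {c} → (∀ i → Graph._~_ H (lookup g i) c) →
                      c ∈ commonNeighbours H g
∈-commonNeighbours⁺ H {g} = ∈-filter⁺ (λ c → all? λ i → Graph._~?_ H (lookup g i) c) (∈-allFin _)

-- The constant tuple at a vertex of maximum degree is full.
fullVecs-nonempty : ∀ {m} (H : Graph m) δ → 0 < maxDegree H → 0 < length (fullVecs H δ)
fullVecs-nonempty H δ 0<Δ with maxDegree-attained H 0<Δ
... | x , deg = ∈-length (∈-filter⁺ (full? H) (∈-allMaps (Vec.replicate δ x))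
  (subst (_≤ length (commonNeighbours H (Vec.replicate δ x))) deg (length-mono-⊆ (neighbours-unique H x) λ {c} c∈ →
     ∈-commonNeighbours⁺ H {Vec.replicate δ x} λ i →
       subst (λ y → Graph._~_ H y c) (sym (lookup-replicate i x)) (∈-neighbours⁻ H c∈))))

isHom-completeBipartite : ∀ {m a b} (H : Graph m) (g : Vec (Fin m) a) (h : Vec (Fin m) b) →
                          (∀ i j → Graph._~_ H (lookup g i) (lookup h j)) →
                          IsHom (completeBipartite a b) H (g Vec.++ h)
isHom-completeBipartite {a = a} H g h adj u v e
  rewrite lookup-splitAt a g h u | lookup-splitAt a g h v with splitAt a u | splitAt a v
... | inj₁ i | inj₂ j = adj i j
... | inj₂ j | inj₁ i = Graph.~-sym H (adj i j)

-- Colour the first part by a full tuple; each vertex of the second part may then take any common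
-- neighbour independently. `Vec.take a` recovers the tuple, so different tuples give different
-- colourings.
hom-completeBipartite-≥ : ∀ {m} (H : Graph m) a b →
                          length (fullVecs H a) * maxDegree H ^ b ≤ hom (completeBipartite a b) H
hom-completeBipartite-≥ {m} H a b = length-≥-fibres (Vec.take a)
  (Unique.filter⁺ (full? H) (allMaps-unique a m)) λ {g} g∈ →
    map (g Vec.++_) (vecsOver (commonNeighbours H g) b)
  , Unique.map⁺ (++-injectiveʳ g g) (vecsOver-unique (Unique.filter⁺ _ (Unique.allFin⁺ m)) b)
  , subst (maxDegree H ^ b ≤_)
      (sym (trans (length-map (g Vec.++_) (vecsOver (commonNeighbours H g) b))
                  (length-vecsOver (commonNeighbours H g) b)))
      (^-monoˡ-≤ b (proj₂ (∈-filter⁻ (full? H) {xs = allMaps a m} g∈)))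
  , λ f∈ → fibre g (∈-map⁻ (g Vec.++_) f∈)
  where
  K = completeBipartite a b
  fibre : ∀ g {f} → ∃[ h ] h ∈ vecsOver (commonNeighbours H g) b × f ≡ g Vec.++ h →
          f ∈ homs K H × Vec.take a f ≡ g
  fibre g (h , h∈ , refl) =
      ∈-homs⁺ K H (isHom-completeBipartite H g h λ i j → ∈-commonNeighbours⁻ H {g} (∈-vecsOver⁻ h∈ j) i)
    , ++-injectiveˡ _ g (take++drop≡id a (g Vec.++ h))

-- This covers both choices of W: N consists of common neighbours of W, or of neighbours of one vertex of W
-- that depends on g.
Blocking : ∀ {n m δ} → SimpleGraph n → Graph m → Vec (Fin n) δ → ℕ → Set
Blocking G H W L = ∀ g → ¬ Full H g → ∃[ N ] Unique N × length N ≡ L × (∀ {v} → v ∈ N → v ∉ toList W) ×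
  (∀ {v} → v ∈ N → ∃[ cs ] length cs ≤ pred (maxDegree H) ×
     (∀ {f} → IsHom G H f → (∀ i → lookup f (lookup W i) ≡ lookup g i) → lookup f v ∈ cs))

-- Graphs with a blocking set of `δ` vertices

module Dominating {n m δ} (G : SimpleGraph n) (H : Graph m) (min-degree : ∀ v → δ ≤ degree (SimpleGraph.graph G) v)
                  (1≤δ : 1 ≤ δ) (few : hom K₂ H < maxDegree H ^ 2)
                  (W : Vec (Fin n) δ) (W-unique : Unique (toList W)) where
  private
    module G = SimpleGraph G
    module H = Graph H
    Δ = maxDegree H
    h = hom K₂ H

  0<Δ : 0 < Δ
  0<Δ = maxDegree-positive H few

  private
    nonisolated = min-degree⇒NoIsolated G.graph 1≤δ min-degree

  open Extension G H nonisolated (<⇒≤ few)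

  Conclusion : ℕ → Set
  Conclusion b = hom G H ≤ hom K H × (hom G H ≡ hom K H → G.graph ≅ SimpleGraph.graph K)
    where K = completeBipartite δ b

  module _ (R : List (Fin n)) (W+R : allFin n ↭ toList W ++ R) where
    private b = length R

    W-or-R : ∀ v → v ∈ toList W ⊎ v ∈ R
    W-or-R v = ∈-++⁻ (toList W) (∈-resp-↭ W+R (∈-allFin v))

    module Independent (R-independent : ∀ {u v} → u ∈ R → v ∈ R → ¬ u G.~ v) where
      private K = completeBipartite δ b

      -- All neighbours of `r` lie in `W`; there are at least `δ` of them and only `δ` places, so
      -- they fill `W`.
      adjacent : ∀ {r} → r ∈ R → ∀ i → lookup W i G.~ r
      adjacent {r} r∈ i = G.~-sym (∈-neighbours⁻ G.graph
        (⊆-reverse (neighbours-unique G.graph r) N⊆W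
          (≤-trans (≤-reflexive (length-toList W)) (min-degree r)) (∈-toList⁺ (∈ᵥ-lookup i W))))
        where
        N⊆W : neighbours G.graph r ⊆ toList W
        N⊆W {d} d∈ with W-or-R d
        ... | inj₁ d∈W = d∈W
        ... | inj₂ d∈R = ⊥-elim (R-independent r∈ d∈R (∈-neighbours⁻ G.graph d∈))

      -- The vertices of `G` with `W` in front, so that `splitAt δ` on positions separates `W` from
      -- `R` just as it separates the parts of `K`.
      V : Vec (Fin n) (δ + b)
      V = W Vec.++ fromList R

      V-unique : Unique (toList V)
      V-unique = subst Unique (sym (trans (toList-++ W (fromList R)) (cong (toList W ++_) (toList∘fromList R))))
        (Unique-resp-↭ W+R (Unique.allFin⁺ n))

      ∈V : ∀ v → v ∈ᵥ V
      ∈V v with W-or-R v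
      ... | inj₁ p = ∈ᵥ-++⁺ˡ (∈-toList⁻ p)
      ... | inj₂ p = ∈ᵥ-++⁺ʳ W (∈-fromList⁺ p)

      position : Fin n → Fin (δ + b)
      position v = AnyV.index (∈V v)

      lookup-position : ∀ v → lookup V (position v) ≡ v
      lookup-position v = sym (lookup-index (∈V v))

      fromListR∈ : ∀ l → lookup (fromList R) l ∈ R
      fromListR∈ l = subst (lookup (fromList R) l ∈_) (toList∘fromList R) (∈-toList⁺ (∈ᵥ-lookup l (fromList R)))

      opposite⇒adjacent : ∀ i j → OppositeSides (splitAt δ i) (splitAt δ j) → lookup V i G.~ lookup V j
      opposite⇒adjacent i j o
        rewrite lookup-splitAt δ W (fromList R) i | lookup-splitAt δ W (fromList R) j with splitAt δ i | splitAt δ j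
      ... | inj₁ k | inj₂ l = adjacent (fromListR∈ l) k
      ... | inj₂ l | inj₁ k = G.~-sym (adjacent (fromListR∈ l) k)

      pull : Vec (Fin m) n → Vec (Fin m) (δ + b)
      pull f = Vec.map (lookup f) V

      lookup-pull : ∀ f k → lookup (pull f) k ≡ lookup f (lookup V k)
      lookup-pull f k = lookup-map k (lookup f) V

      pull-injective : ∀ {f g} → pull f ≡ pull g → f ≡ g
      pull-injective {f} {g} eq = lookup-ext λ v → begin
        lookup f v                        ≡⟨ cong (lookup f) (lookup-position v) ⟨
        lookup f (lookup V (position v))  ≡⟨ lookup-pull f (position v) ⟨
        lookup (pull f) (position v)      ≡⟨ cong (λ p → lookup p (position v)) eq ⟩
        lookup (pull g) (position v)      ≡⟨ lookup-pull g (position v) ⟩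
        lookup g (lookup V (position v))  ≡⟨ cong (lookup g) (lookup-position v) ⟩
        lookup g v                        ∎
        where open ≡-Reasoning

      pulled : List (Vec (Fin m) (δ + b))
      pulled = map pull (homs G H)

      pulled-unique : Unique pulled
      pulled-unique = Unique.map⁺ pull-injective (homs-unique G H)

      -- Along `V` every edge of `K` is an edge of `G`, so a homomorphism from `G` meets all
      -- constraints of `K`.
      pulled⊆ : pulled ⊆ homs K H
      pulled⊆ p∈ with ∈-map⁻ pull p∈
      ... | f , f∈ , refl = ∈-homs⁺ K H λ i j o →
        subst₂ H._~_ (sym (lookup-pull f i)) (sym (lookup-pull f j))
               (∈-homs⁻ G H f∈ (lookup V i) (lookup V j) (opposite⇒adjacent i j o))

      |pulled| : length pulled ≡ hom G H
      |pulled| = length-map pull (homs G H)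

      hom-≤ : hom G H ≤ hom K H
      hom-≤ = subst (_≤ hom K H) |pulled| (length-mono-⊆ pulled-unique pulled⊆)

      module InnerEdge {i j} (e : lookup W i G.~ lookup W j) where
        i≢j : i ≢ j
        i≢j refl = G.loopless refl e

        module _ {x a c} (x~a : x H.~ a) (x~c : x H.~ c) (a≁c : ¬ a H.~ c) where
          -- Only `j` receives `c`, so the inner edge gets the non-adjacent pair `a`, `c`, while all
          -- of `W` stays adjacent to the colour `x` used on `R`. The case `a ≡ c` of an unlooped
          -- colour is included.
          colour : Fin δ → Fin m
          colour k = if does (k ≟ j) then c else a

          w : Vec (Fin m) δ
          w = Vec.tabulate colour

          x~colour : ∀ k → x H.~ colour k
          x~colour k with does (k ≟ j)
          ... | true  = x~c
          ... | false = x~a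

          f₀ : Vec (Fin m) (δ + b)
          f₀ = w Vec.++ Vec.replicate b x

          f₀∈ : f₀ ∈ homs K H
          f₀∈ = ∈-homs⁺ K H (isHom-completeBipartite H w (Vec.replicate b x) λ k l →
            subst₂ H._~_ (sym (lookup∘tabulate colour k)) (sym (lookup-replicate l x)) (H.~-sym (x~colour k)))

          f₀∉ : f₀ ∉ pulled
          f₀∉ p∈ with ∈-map⁻ pull p∈
          ... | f , f∈ , eq = a≁c (subst₂ H._~_ (value i (cong (λ q → if q then c else a) (dec-false (i ≟ j) i≢j)))
                                                (value j (cong (λ q → if q then c else a) (dec-true (j ≟ j) refl)))
                                                (∈-homs⁻ G H f∈ _ _ e))
            where
            value : ∀ k {y} → colour k ≡ y → lookup f (lookup W k) ≡ y
            value k {y} ck≡y = begin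
              lookup f (lookup W k)                          ≡⟨ cong (lookup f) (lookup-++ˡ W (fromList R) k) ⟨
              lookup f (lookup V (k ↑ˡ b))                   ≡⟨ lookup-pull f (k ↑ˡ b) ⟨
              lookup (pull f) (k ↑ˡ b)                       ≡⟨ cong (λ p → lookup p (k ↑ˡ b)) eq ⟨
              lookup f₀ (k ↑ˡ b)                             ≡⟨ lookup-++ˡ w _ k ⟩
              lookup w k                                     ≡⟨ lookup∘tabulate colour k ⟩
              colour k                                       ≡⟨ ck≡y ⟩
              y                                              ∎
              where open ≡-Reasoning

        -- The colouring `f₀` of `K` is missed by the injection `pull`.
        hom-< : hom G H < hom K H
        hom-< =
          let x , deg = maxDegree-attained H 0<Δ
              a , c , x~a , x~c , a≁c = neighbours-not-clique H (subst (λ d → h < d ^ 2) (sym deg) few)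
          in subst (_≤ hom K H) (cong suc |pulled|)
               (length-mono-⊆ (All.tabulate (λ { g∈ refl → f₀∉ x~a x~c a≁c g∈ }) ∷ pulled-unique)
                              λ { (here refl) → f₀∈ x~a x~c a≁c ; (there g∈) → pulled⊆ g∈ })

      isomorphic : (∀ i j → ¬ lookup W i G.~ lookup W j) → G.graph ≅ SimpleGraph.graph K
      isomorphic W-independent =
          mk↔ₛ′ position (lookup V) (λ i → lookup-injective V-unique (lookup-position (lookup V i))) lookup-position
        , λ u v → mk⇔ (λ u~v → adjacent⇒opposite _ _ (subst₂ G._~_ (sym (lookup-position u)) (sym (lookup-position v)) u~v))
                      (λ o → subst₂ G._~_ (lookup-position u) (lookup-position v) (opposite⇒adjacent _ _ o))
        where
        adjacent⇒opposite : ∀ i j → lookup V i G.~ lookup V j → OppositeSides (splitAt δ i) (splitAt δ j)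
        adjacent⇒opposite i j e
          rewrite lookup-splitAt δ W (fromList R) i | lookup-splitAt δ W (fromList R) j with splitAt δ i | splitAt δ j
        ... | inj₁ k | inj₁ l = ⊥-elim (W-independent k l e)
        ... | inj₁ k | inj₂ l = _
        ... | inj₂ k | inj₁ l = _
        ... | inj₂ k | inj₂ l = ⊥-elim (R-independent (fromListR∈ k) (fromListR∈ l) e)

      conclusion : Conclusion b
      conclusion = [ (λ (i , j , e) → hom-≤ , λ eq → ⊥-elim (<⇒≢ (InnerEdge.hom-< e) eq))
                   , (λ none → hom-≤ , λ _ → isomorphic λ i j e → none (i , j , e)) ]′
                   (toSum (any? λ i → any? λ j → lookup W i G.~? lookup W j))

    pinned-covers : ∀ {ys} {g : Vec (Fin m) δ} → (∀ {f} → f ∈ ys → ∀ i → lookup f (lookup W i) ≡ lookup g i) → Covers ys R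
    pinned-covers {ys} {g} pinned v = ⊎-map₁ determined (W-or-R v)
      where
      determined : v ∈ toList W → Determined ys v
      determined v∈W {f} {f′} f∈ f′∈ = subst (λ u → lookup f u ≡ lookup f′ u) (sym (lookup-index v∈))
        (trans (pinned f∈ (AnyV.index v∈)) (sym (pinned f′∈ (AnyV.index v∈))))
        where v∈ = ∈-toList⁻ v∈W

  module _ {L} (blocking : Blocking G H W L) (gap : m ^ δ * pred Δ ^ L * Δ ^ 2 < Δ ^ L)
           (R : List (Fin n)) (W+R : allFin n ↭ toList W ++ R) where
    private
      b = length R
      K = completeBipartite δ b
      F? = λ f → full? H (Vec.map (lookup f) W)
      full = filter F? (homs G H)
      rest = filter (¬? ∘ F?) (homs G H)
      restVecs = filter (¬? ∘ full? H) (allMaps δ m)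
      s = length (fullVecs H δ)

    module AdjacentPair {u v R′} (u~v : u G.~ v) (R↭ : R ↭ u ∷ v ∷ R′) where
      private
        x = length R′

        b≡2+x : b ≡ 2 + x
        b≡2+x = ↭-length R↭

      -- Once `W` carries one of the `s` full tuples, the edge inside `R` takes at most `h` ways,
      -- and `extend` handles the other `x` vertices.
      full-≤ : length full ≤ s * (h * Δ ^ x)
      full-≤ = colour-vertices W (restrict F? homsFamily)
        (λ f∈ → ∈-filter⁺ (full? H) (∈-allMaps _) (proj₂ (∈-filter⁻ F? {xs = homs G H} f∈)))
        λ {_} {g} _ _ 𝓖 pinned →
          colour-edge 𝓖 u~v (covers-⊆ (∈-resp-↭ R↭) (pinned-covers R W+R {g = g} pinned)) (extend x R′ refl)

      N⊆R : ∀ {N} → (∀ {v} → v ∈ N → v ∉ toList W) → N ⊆ R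
      N⊆R N∩W v∈ = fromInj₂ (λ v∈W → ⊥-elim (N∩W v∈ v∈W)) (W-or-R R W+R _)

      -- For each tuple that is not full, `blocking` supplies `L` vertices of `R` with at most
      -- `pred Δ` colours each; these vertices may vary with the tuple.
      rest-≤ : length rest ≤ length restVecs * (pred Δ ^ L * Δ ^ (b ∸ L))
      rest-≤ = colour-vertices W (restrict (¬? ∘ F?) homsFamily)
        (λ f∈ → ∈-filter⁺ (¬? ∘ full? H) (∈-allMaps _) (proj₂ (∈-filter⁻ (¬? ∘ F?) {xs = homs G H} f∈)))
        λ {ys} {g} g∈ _ 𝓖 pinned →
          let N , uN , |N| , N∩W , few-colours = blocking g (proj₂ (∈-filter⁻ (¬? ∘ full? H) {xs = allMaps δ m} g∈))
              R″ , R↭N+R″ = complement uN (N⊆R N∩W)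
              |R″| : length R″ ≡ b ∸ L
              |R″| = sym (trans (cong₂ _∸_ (trans (↭-length R↭N+R″) (length-++ N)) (sym |N|)) (m+n∸m≡n (length N) _))
          in subst₂ (λ k l → length ys ≤ pred Δ ^ k * Δ ^ l) |N| |R″|
               (extend-restricted N R″
                 (All.tabulate λ v∈ → let cs , |cs| , in-cs = few-colours v∈
                                      in cs , |cs| , λ {f} f∈ → in-cs {f} (Family.isHom 𝓖 f∈) (pinned f∈))
                 𝓖 (covers-⊆ (∈-resp-↭ R↭N+R″) (pinned-covers R W+R {g = g} pinned)))

      rest-< : length rest < Δ ^ x
      rest-< = ≤-<-trans rest-≤ (small restVecs |restVecs| L≤b)
        where
        |restVecs| : length restVecs ≤ m ^ δ
        |restVecs| = ≤-trans (length-filter (¬? ∘ full? H) (allMaps δ m)) (≤-reflexive (length-allMaps δ m))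

        L≤b : ∀ {g} → g ∈ restVecs → L ≤ b
        L≤b {g} g∈ =
          let N , uN , |N| , N∩W , _ = blocking g (proj₂ (∈-filter⁻ (¬? ∘ full? H) {xs = allMaps δ m} g∈))
          in subst (_≤ b) |N| (length-mono-⊆ uN (N⊆R N∩W))

        -- That `R` has `L` vertices is known only from a blocking list, hence only if some tuple is
        -- not full. Without such a tuple the count is zero and the truncation in `b ∸ L` does no
        -- harm.
        small : ∀ (gs : List (Vec (Fin m) δ)) → length gs ≤ m ^ δ → (∀ {g} → g ∈ gs → L ≤ b) →
                length gs * (pred Δ ^ L * Δ ^ (b ∸ L)) < Δ ^ x
        small []         _    _   = >-nonZero⁻¹ _ ⦃ ^-pos 0<Δ x ⦄
        small gs@(_ ∷ _) |gs| L≤b = *-cancelʳ-< (Δ ^ 2) _ _ (begin-strict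
          length gs * (pred Δ ^ L * Δ ^ (b ∸ L)) * Δ ^ 2  ≤⟨ *-monoˡ-≤ (Δ ^ 2) (*-monoˡ-≤ _ |gs|) ⟩
          m ^ δ * (pred Δ ^ L * Δ ^ (b ∸ L)) * Δ ^ 2      ≡⟨ rearrange (m ^ δ) (pred Δ ^ L) (Δ ^ (b ∸ L)) (Δ ^ 2) ⟩
          m ^ δ * pred Δ ^ L * Δ ^ 2 * Δ ^ (b ∸ L)        <⟨ *-monoˡ-< (Δ ^ (b ∸ L)) ⦃ ^-pos 0<Δ (b ∸ L) ⦄ gap ⟩
          Δ ^ L * Δ ^ (b ∸ L)                             ≡⟨ ^-distribˡ-+-* Δ L (b ∸ L) ⟨
          Δ ^ (L + (b ∸ L))                               ≡⟨ cong (Δ ^_) (trans (m+[n∸m]≡n (L≤b (here refl))) b≡2+x) ⟩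
          Δ ^ (2 + x)                                     ≡⟨ ^-distribˡ-+-* Δ 2 x ⟩
          Δ ^ 2 * Δ ^ x                                   ≡⟨ *-comm (Δ ^ 2) _ ⟩
          Δ ^ x * Δ ^ 2                                   ∎)
          where
          open ≤-Reasoning
          rearrange : ∀ a p q r → a * (p * q) * r ≡ a * p * r * q
          rearrange = solve 4 (λ a p q r → a :* (p :* q) :* r := a :* p :* r :* q) refl
            where open +-*-Solver

      hom-< : hom G H < hom K H
      hom-< = begin-strict
        hom G H                       ≡⟨ length-filter-split F? (homs G H) ⟩
        length full + length rest     <⟨ +-mono-≤-< full-≤ rest-< ⟩
        s * (h * Δ ^ x) + Δ ^ x       ≤⟨ +-monoʳ-≤ (s * (h * Δ ^ x)) (m≤n*m (Δ ^ x) s ⦃ >-nonZero (fullVecs-nonempty H δ 0<Δ) ⦄) ⟩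
        s * (h * Δ ^ x) + s * Δ ^ x   ≡⟨ *-distribˡ-+ s _ _ ⟨
        s * (h * Δ ^ x + Δ ^ x)       ≡⟨ cong (s *_) (+-comm _ (Δ ^ x)) ⟩
        -- Since `suc h ≤ Δ ^ 2`, the gap of one between `h` and `Δ ^ 2` pays for all colourings
        -- whose tuple on `W` is not full.
        s * (suc h * Δ ^ x)           ≤⟨ *-monoʳ-≤ s (*-monoˡ-≤ (Δ ^ x) few) ⟩
        s * (Δ ^ 2 * Δ ^ x)           ≡⟨ cong (s *_) (^-distribˡ-+-* Δ 2 x) ⟨
        s * Δ ^ (2 + x)               ≡⟨ cong (λ k → s * Δ ^ k) b≡2+x ⟨
        s * Δ ^ b                     ≤⟨ hom-completeBipartite-≥ H δ b ⟩
        hom K H                       ∎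
        where open ≤-Reasoning

    dichotomy : Conclusion b
    dichotomy = [ (λ (u , v , R′ , u~v , R↭) → let lt = AdjacentPair.hom-< u~v R↭ in <⇒≤ lt , λ eq → ⊥-elim (<⇒≢ lt eq))
                , Independent.conclusion R W+R ]′
                (adjacent-pair? G R (Unique-++⁻ʳ (toList W) (Unique-resp-↭ W+R (Unique.allFin⁺ n))))

  conclusion : ∀ {L} → Blocking G H W L → m ^ δ * pred Δ ^ L * Δ ^ 2 < Δ ^ L → Conclusion (n ∸ δ)
  conclusion blocking gap =
    let R , W+R = complement W-unique λ _ → ∈-allFin _
        n≡δ+b = trans (sym (length-allFin n)) (trans (↭-length W+R)
                  (trans (length-++ (toList W)) (cong (_+ length R) (length-toList W))))
    in subst Conclusion (sym (trans (cong (_∸ δ) n≡δ+b) (m+n∸m≡n δ (length R)))) (dichotomy blocking gap R W+R)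

-- Vertex covers

-- The search stops at `k` edges, as that many already make `hom G H` too small. If it stops
-- earlier, the rest `I` is independent, so `flatten M` is a vertex cover.
greedy-matching : ∀ {n} (G : SimpleGraph n) → let open SimpleGraph G in ∀ k us → Unique us →
                  ∃[ M ] ∃[ I ] All (λ (u , v) → u ~ v) M × us ↭ flatten M ++ I ×
                  (length M ≡ k ⊎ length M ≤ k × (∀ {u v} → u ∈ I → v ∈ I → ¬ u ~ v))
greedy-matching G zero    us uniq = [] , us , [] , ↭-refl , inj₁ refl
greedy-matching G (suc k) us uniq with adjacent-pair? G us uniq
... | inj₂ independent = [] , us , [] , ↭-refl , inj₂ (z≤n , independent)
... | inj₁ (u , v , us′ , e , us↭) =
  let M , I , es , us′↭ , size = greedy-matching G k us′ (Unique-++⁻ʳ (u ∷ v ∷ []) (Unique-resp-↭ us↭ uniq))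
  in (u , v) ∷ M , I , e ∷ es , ↭-trans us↭ (prep u (prep v us′↭))
   , ⊎-map (cong suc) (λ (le , independent) → s≤s le , independent) size

-- If all entries had degree `Δ`, their shared neighbours would all be common neighbours and the
-- tuple would be full.
low-degree-colour : ∀ {m δ} (H : Graph m) → 1 ≤ δ → MaxDegreeVerticesShareNeighbours H →
                    ∀ (g : Vec (Fin m) δ) → ¬ Full H g → ∃[ i ] degree H (lookup g i) < maxDegree H
low-degree-colour {δ = suc _} H 1≤δ share g ¬full with any? (λ i → degree H (lookup g i) <? maxDegree H)
... | yes found = found
... | no  none  = ⊥-elim (¬full (subst (_≤ length (commonNeighbours H g)) (deg zero)
    (length-mono-⊆ (neighbours-unique H (lookup g zero)) λ {c} c∈ → ∈-commonNeighbours⁺ H {g} λ i →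
      Equivalence.to (share (lookup g zero) (lookup g i) (deg zero) (deg i) c) (∈-neighbours⁻ H c∈))))
  where
  deg : ∀ i → degree H (lookup g i) ≡ maxDegree H
  deg i = ≤∧≮⇒≡ (degree≤maxDegree H (lookup g i)) λ lt → none (i , lt)

module VertexCover {n m δ} (G : SimpleGraph n) (H : Graph m)
                   (min-degree : ∀ v → δ ≤ degree (SimpleGraph.graph G) v) {C I : List (Fin n)} (C+I : allFin n ↭ C ++ I)
                   (independent : ∀ {u v} → u ∈ I → v ∈ I → ¬ SimpleGraph._~_ G u v) where
  open SimpleGraph G
  private
    C++I-unique : Unique (C ++ I)
    C++I-unique = Unique-resp-↭ C+I (Unique.allFin⁺ n)

    C-unique : Unique C
    C-unique = Unique-++⁻ˡ C C++I-unique

    I-unique : Unique I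
    I-unique = Unique-++⁻ʳ C C++I-unique

  |C|+|I| : length C + length I ≡ n
  |C|+|I| = trans (sym (length-++ C)) (trans (sym (↭-length C+I)) (length-allFin n))

  degree-in-cover : ∀ {v} → v ∈ I → δ ≤ length (filter (v ~?_) C)
  degree-in-cover {v} v∈ = ≤-trans (min-degree v) (length-mono-⊆ (neighbours-unique graph v) λ w∈ →
    let v~w = ∈-neighbours⁻ graph w∈
    in ∈-filter⁺ (v ~?_) (fromInj₁ (λ w∈I → ⊥-elim (independent v∈ w∈I v~w)) (∈-++⁻ C (∈-resp-↭ C+I (∈-allFin _)))) v~w)

  -- Take many vertices `N` of `I` with one common trace `A` on `C`. It has at least `δ` members,
  -- being the neighbourhood in `C` of a vertex of `I`, and any `δ` of them serve as `W`: colours on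
  -- `N` are then common neighbours of `g`, fewer than `Δ` if `g` is not full.
  blocking-common : ∀ {L} → 1 ≤ L → 2 ^ length C * L ≤ length I →
                    ∃[ W ] Unique (toList W) × Blocking {δ = δ} G H W L
  blocking-common {L} 1≤L large =
    let A , N , uN , N⊆I , L≤|N| , trace = common-trace _~?_ C I-unique large
        x , x∈N = inhabited (≤-trans 1≤L L≤|N|)
        W , uW , W⊆A = choose (subst Unique (trace x∈N) (Unique.filter⁺ (x ~?_) C-unique))
                              (subst (λ A → δ ≤ length A) (trace x∈N) (degree-in-cover (N⊆I x∈N)))
        adjacent : ∀ {v w} → v ∈ N → w ∈ toList W → v ~ w
        adjacent {v} {w} v∈ w∈ = proj₂ (∈-filter⁻ (v ~?_) {xs = C} (subst (w ∈_) (sym (trace v∈)) (W⊆A w∈)))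
    in W , uW , λ g ¬full →
        take L N , Unique.take⁺ L uN , length-take-≤ L≤|N|
      , (λ v∈ v∈W → loopless refl (adjacent (take-⊆ L v∈) v∈W))
      , λ {v} v∈ → commonNeighbours H g , <⇒≤pred (≰⇒> ¬full)
        , λ {f} f-hom f≡g → ∈-commonNeighbours⁺ H {g} λ i →
            subst (λ c → Graph._~_ H c (lookup f v)) (f≡g i)
              (f-hom (lookup W i) v (~-sym (adjacent (take-⊆ L v∈) (∈-toList⁺ (∈ᵥ-lookup i W)))))

  module _ (1≤δ : 1 ≤ δ) (share : MaxDegreeVerticesShareNeighbours H) {L} (large : length C * L < length I) where
    private
      popular? : Decidable (λ c → L ≤ length (filter (c ~?_) I))
      popular? c = L ≤? length (filter (c ~?_) I)
      popular   = filter popular? C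
      unpopular = filter (¬? ∘ popular?) C

    -- With fewer than `δ` popular vertices, each vertex of `I` would have an unpopular neighbour in
    -- `C`. Unpopular vertices reach fewer than `L` vertices of `I` each, so `I` would have at most
    -- `length C * L` members.
    enough-popular : δ ≤ length popular
    enough-popular = decidable-stable (δ ≤? length popular) λ δ≰ →
      <⇒≱ large (≤-trans
        (length-≤-cover (λ c → filter (c ~?_) I) I-unique (unpopular-neighbour δ≰)
          (λ c∈ → <⇒≤ (≰⇒> (proj₂ (∈-filter⁻ (¬? ∘ popular?) {xs = C} c∈)))))
        (*-monoˡ-≤ L (length-filter (¬? ∘ popular?) C)))
      where
      unpopular-neighbour : ¬ δ ≤ length popular → ∀ {v} → v ∈ I → ∃[ c ] c ∈ unpopular × v ∈ filter (c ~?_) I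
      unpopular-neighbour δ≰ {v} v∈ with Any.any? (v ~?_) unpopular
      ... | yes p = let c , c∈ , v~c = find p in c , c∈ , ∈-filter⁺ (c ~?_) v∈ (~-sym v~c)
      ... | no none = ⊥-elim (δ≰ (≤-trans (degree-in-cover v∈)
        (length-mono-⊆ (Unique.filter⁺ (v ~?_) C-unique) λ {c} c∈ →
          let c∈C , v~c = ∈-filter⁻ (v ~?_) {xs = C} c∈
          in ∈-filter⁺ popular? c∈C (decidable-stable (popular? c) λ ¬pop →
               none (lose (∈-filter⁺ (¬? ∘ popular?) c∈C ¬pop) v~c)))))

    -- A tuple that is not full has an entry `i` of degree below `Δ`. It alone restricts the colours
    -- on `L` neighbours of `lookup W i` in `I`, and popularity provides so many.
    blocking-shared : ∃[ W ] Unique (toList W) × Blocking {δ = δ} G H W L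
    blocking-shared =
      let W , uW , W⊆ = choose (Unique.filter⁺ popular? C-unique) enough-popular
      in W , uW , λ g ¬full →
        let i , low = low-degree-colour H 1≤δ share g ¬full
            w = lookup W i
            near : List (Fin n)
            near = filter (w ~?_) I
            near-∈ : ∀ {v} → v ∈ take L near → v ∈ I × w ~ v
            near-∈ v∈ = ∈-filter⁻ (w ~?_) (take-⊆ L v∈)
        in take L near , Unique.take⁺ L (Unique.filter⁺ (w ~?_) I-unique)
         , length-take-≤ (proj₂ (∈-filter⁻ popular? {xs = C} (W⊆ (∈-toList⁺ (∈ᵥ-lookup i W)))))
         , (λ v∈ v∈W → Unique-++⇒disjoint C C++I-unique (proj₁ (∈-filter⁻ popular? (W⊆ v∈W))) (proj₁ (near-∈ v∈)))
         , λ {v} v∈ → neighbours H (lookup g i) , <⇒≤pred low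
           , λ {f} f-hom f≡g → ∈-neighbours⁺ H (subst (λ c → Graph._~_ H c (lookup f v)) (f≡g i) (f-hom w v (proj₂ (near-∈ v∈))))

-- Choice of the constants and the bounds for large `n`

module Threshold {m} (H : Graph m) (few : hom K₂ H < maxDegree H ^ 2)
                 {κ} (κ-gap : hom K₂ H ^ κ * maxDegree H < (maxDegree H ^ 2) ^ κ)
                 {ℓ} (0<ℓ : 0 < ℓ) (ℓ-gap : pred (maxDegree H) ^ ℓ * (m * maxDegree H ^ 2) < maxDegree H ^ ℓ) where
  private
    Δ = maxDegree H
    h = hom K₂ H

    0<Δ : 0 < Δ
    0<Δ = maxDegree-positive H few

  module _ {δ} (1≤δ : 1 ≤ δ) where
    private
      k = κ * δ
      L = ℓ * δ
      instance
        δ-nonZero = >-nonZero 1≤δ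

    -- The `δ`-th power of `κ-gap`. The factor `Δ ^ δ` is what the lower bound `Δ ^ (n ∸ δ)` for `K`
    -- lacks against `Δ ^ n`.
    matching-gap : h ^ k * Δ ^ δ < Δ ^ (2 * k)
    matching-gap = begin-strict
      h ^ k * Δ ^ δ          ≡⟨ cong (_* Δ ^ δ) (^-*-assoc h κ δ) ⟨
      (h ^ κ) ^ δ * Δ ^ δ    ≡⟨ ^-distribʳ-* (h ^ κ) Δ δ ⟨
      (h ^ κ * Δ) ^ δ        <⟨ ^-monoˡ-< δ (κ-gap) ⟩
      ((Δ ^ 2) ^ κ) ^ δ      ≡⟨ ^-*-assoc (Δ ^ 2) κ δ ⟩
      (Δ ^ 2) ^ k            ≡⟨ ^-*-assoc Δ 2 k ⟩
      Δ ^ (2 * k)            ∎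
      where open ≤-Reasoning

    -- After `Δ ^ 2` is enlarged to `(Δ ^ 2) ^ δ`, this is the `δ`-th power of `ℓ-gap`.
    blocking-gap : m ^ δ * pred Δ ^ L * Δ ^ 2 < Δ ^ L
    blocking-gap = begin-strict
      m ^ δ * pred Δ ^ L * Δ ^ 2           ≤⟨ *-monoʳ-≤ (m ^ δ * pred Δ ^ L) (m≤m^n (Δ ^ 2) 1≤δ) ⟩
      m ^ δ * pred Δ ^ L * (Δ ^ 2) ^ δ     ≡⟨ rearrange (m ^ δ) (pred Δ ^ L) ((Δ ^ 2) ^ δ) ⟩
      pred Δ ^ L * (m ^ δ * (Δ ^ 2) ^ δ)   ≡⟨ cong₂ _*_ (^-*-assoc (pred Δ) ℓ δ) (^-distribʳ-* m (Δ ^ 2) δ) ⟨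
      (pred Δ ^ ℓ) ^ δ * (m * Δ ^ 2) ^ δ   ≡⟨ ^-distribʳ-* (pred Δ ^ ℓ) (m * Δ ^ 2) δ ⟨
      (pred Δ ^ ℓ * (m * Δ ^ 2)) ^ δ       <⟨ ^-monoˡ-< δ (ℓ-gap) ⟩
      (Δ ^ ℓ) ^ δ                          ≡⟨ ^-*-assoc Δ ℓ δ ⟩
      Δ ^ L                                ∎
      where
      open ≤-Reasoning
      rearrange : ∀ a p q → a * p * q ≡ p * (a * q)
      rearrange = solve 3 (λ a p q → a :* p :* q := p :* (a :* q)) refl
        where open +-*-Solver

    module _ {n} (G : SimpleGraph n) (min-degree : ∀ v → δ ≤ degree (SimpleGraph.graph G) v) where
      open SimpleGraph G
      private
        K = completeBipartite δ (n ∸ δ)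
        nonisolated = min-degree⇒NoIsolated graph 1≤δ min-degree

      -- Colouring along the matching gives at most `h ^ k * Δ ^ (n ∸ 2 * k)` homomorphisms, while a
      -- single full tuple gives `K` at least `Δ ^ (n ∸ δ)`; multiplying by `Δ ^ δ` makes the two
      -- comparable.
      hom-large-matching : ∀ {M I} → All (λ (u , v) → u ~ v) M → allFin n ↭ flatten M ++ I → length M ≡ k →
                           hom G H < hom K H
      hom-large-matching {M} {I} es M+I |M|≡k = *-cancelʳ-< (Δ ^ δ) _ _ (begin-strict
        hom G H * Δ ^ δ                 ≤⟨ *-monoˡ-≤ (Δ ^ δ) (extend-matching M I es homsFamily
                                             λ v → inj₂ (∈-resp-↭ M+I (∈-allFin v))) ⟩
        h ^ length M * Δ ^ r * Δ ^ δ    ≡⟨ cong (λ k → h ^ k * Δ ^ r * Δ ^ δ) |M|≡k ⟩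
        h ^ k * Δ ^ r * Δ ^ δ           ≡⟨ rearrange (h ^ k) (Δ ^ r) (Δ ^ δ) ⟩
        h ^ k * Δ ^ δ * Δ ^ r           <⟨ *-monoˡ-< (Δ ^ r) ⦃ ^-pos 0<Δ r ⦄ matching-gap ⟩
        Δ ^ (2 * k) * Δ ^ r             ≡⟨ ^-distribˡ-+-* Δ (2 * k) r ⟨
        Δ ^ (2 * k + r)                 ≡⟨ cong (Δ ^_) n≡2k+r ⟨
        -- `n ≤ δ + (n ∸ δ)` holds whether or not the subtraction truncates.
        Δ ^ n                           ≤⟨ ^-monoʳ-≤ Δ ⦃ >-nonZero 0<Δ ⦄ (m≤n+m∸n n δ) ⟩
        Δ ^ (δ + (n ∸ δ))               ≡⟨ ^-distribˡ-+-* Δ δ (n ∸ δ) ⟩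
        Δ ^ δ * Δ ^ (n ∸ δ)             ≡⟨ *-comm (Δ ^ δ) _ ⟩
        Δ ^ (n ∸ δ) * Δ ^ δ             ≤⟨ *-monoˡ-≤ (Δ ^ δ) (≤-trans
                                             (m≤n*m (Δ ^ (n ∸ δ)) _ ⦃ >-nonZero (fullVecs-nonempty H δ 0<Δ) ⦄)
                                             (hom-completeBipartite-≥ H δ (n ∸ δ))) ⟩
        hom K H * Δ ^ δ                 ∎)
        where
        open ≤-Reasoning
        open Extension G H nonisolated (<⇒≤ few)
        r = length I
        n≡2k+r : n ≡ 2 * k + r
        n≡2k+r = trans (sym (length-allFin n)) (trans (↭-length M+I) (trans (length-++ (flatten M))
          (cong (_+ r) (trans (length-flatten M) (cong (2 *_) |M|≡k)))))
        rearrange : ∀ a p q → a * p * q ≡ a * q * p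
        rearrange = solve 3 (λ a p q → a :* p :* q := a :* q :* p) refl
          where open +-*-Solver

      maximised-if-blocking :
        (∀ {C I} → allFin n ↭ C ++ I → (∀ {u v} → u ∈ I → v ∈ I → ¬ u ~ v) → length C ≤ 2 * k →
           ∃[ W ] Unique (toList W) × Blocking {δ = δ} G H W L) →
        hom G H ≤ hom K H × (hom G H ≡ hom K H → graph ≅ SimpleGraph.graph K)
      maximised-if-blocking block = finish (greedy-matching G k (allFin n) (Unique.allFin⁺ n))
        where
        finish : ∃[ M ] ∃[ I ] All (λ (u , v) → u ~ v) M × allFin n ↭ flatten M ++ I ×
                   (length M ≡ k ⊎ length M ≤ k × (∀ {u v} → u ∈ I → v ∈ I → ¬ u ~ v)) →
                 hom G H ≤ hom K H × (hom G H ≡ hom K H → graph ≅ SimpleGraph.graph K)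
        finish (M , I , es , M+I , inj₁ |M|≡k) =
          let lt = hom-large-matching es M+I |M|≡k in <⇒≤ lt , λ eq → ⊥-elim (<⇒≢ lt eq)
        finish (M , I , es , M+I , inj₂ (|M|≤k , independent)) =
          let W , uW , blocking = block M+I independent
                (≤-trans (≤-reflexive (length-flatten M)) (*-monoʳ-≤ 2 |M|≤k))
          in Dominating.conclusion G H min-degree 1≤δ few W uW blocking blocking-gap

  exponential : ∀ δ → 1 ≤ δ → ∀ n → (2 ^ (2 * κ) * ((2 * κ + ℓ) * 2)) ^ δ ≤ n → UniquelyMaximised H δ n
  exponential δ 1≤δ n large G (min-degree , _) =
    maximised-if-blocking 1≤δ G min-degree λ {C} {I} C+I independent |C|≤ →
      VertexCover.blocking-common G H min-degree C+I independent (≤-trans 1≤δ (m≤n*m δ ℓ ⦃ >-nonZero 0<ℓ ⦄))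
        -- Adding `length C` to both sides turns the demand on `length I` into one on `n`.
        (+-cancelˡ-≤ (length C) _ _ (begin
          length C + 2 ^ length C * (ℓ * δ)           ≤⟨ +-mono-≤ |C|≤ (*-monoˡ-≤ (ℓ * δ) (^-monoʳ-≤ 2 |C|≤)) ⟩
          2 * (κ * δ) + 2 ^ (2 * (κ * δ)) * (ℓ * δ)   ≤⟨ exponential-threshold κ ℓ 1≤δ ⟩
          (2 ^ (2 * κ) * ((2 * κ + ℓ) * 2)) ^ δ       ≤⟨ large ⟩
          n                                           ≡⟨ VertexCover.|C|+|I| G H min-degree C+I independent ⟨
          length C + length I                         ∎))
    where open ≤-Reasoning

  quadratic : MaxDegreeVerticesShareNeighbours H →
              ∀ δ → 1 ≤ δ → ∀ n → suc (2 * κ + 2 * κ * ℓ) * δ ^ 2 ≤ n → UniquelyMaximised H δ n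
  quadratic share δ 1≤δ n large G (min-degree , _) =
    maximised-if-blocking 1≤δ G min-degree λ {C} {I} C+I independent |C|≤ →
      VertexCover.blocking-shared G H min-degree C+I independent 1≤δ share
        (+-cancelˡ-< (length C) _ _ (begin-strict
          length C + length C * (ℓ * δ)          ≤⟨ +-mono-≤ |C|≤ (*-monoˡ-≤ (ℓ * δ) |C|≤) ⟩
          2 * (κ * δ) + 2 * (κ * δ) * (ℓ * δ)    <⟨ quadratic-threshold κ ℓ 1≤δ ⟩
          suc (2 * κ + 2 * κ * ℓ) * δ ^ 2        ≤⟨ large ⟩
          n                                      ≡⟨ VertexCover.|C|+|I| G H min-degree C+I independent ⟨
          length C + length I                    ∎))
    where open ≤-Reasoning

theorem1p6 : ∀ {m} (H : Graph m) → NoIsolated H → hom K₂ H < maxDegree H ^ 2 →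
    (∃[ c ] (∀ δ → 1 ≤ δ → ∀ n → c ^ δ ≤ n → UniquelyMaximised H δ n))
    × (MaxDegreeVerticesShareNeighbours H →
    ∃[ c ] (∀ δ → 1 ≤ δ → ∀ n → c * δ ^ 2 ≤ n → UniquelyMaximised H δ n))
theorem1p6 {m} H _ few =
  -- With `κ = suc k`, a matching of `κ * δ` edges costs more than the factor `Δ ^ δ`; with
  -- `ℓ = suc l`, the loss at `ℓ * δ` blocked vertices outweighs all `m ^ δ` tuples on `W` and a
  -- further factor `Δ ^ 2`.
  let k , κ-gap = exponential-gap few (maxDegree H)
      l , ℓ-gap = exponential-gap
        (≤-reflexive (suc-pred (maxDegree H) ⦃ >-nonZero (maxDegree-positive H few) ⦄)) (m * maxDegree H ^ 2)
      open Threshold H few {suc k} κ-gap {suc l} z<s ℓ-gap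
  -- Unification fills in the base `2 ^ (2 * κ) * ((2 * κ + ℓ) * 2)`.
  in (_ , exponential) , λ share → suc (2 * suc k + 2 * suc k * suc l) , quadratic share
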